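{- For all $r\ge 2$ and $\ell\in\{2,3,5\}$, $$\mathrm{ex}\left(n,\{TC^r_{r+1},TC^r_{r+2},\ldots,TC^r_{\ell r}\}\right)=\Omega\left(n^{r-1+1/\ell}\right).$$
   Context: An $r$-graph is an $r$-uniform hypergraph. For integers $r<k$, the tight $k$-cycle $TC^r_k$ is the $r$-graph on vertices $u_0,\ldots,u_{k-1}$ with edges $\{u_i,u_{i+1},\ldots,u_{i+r-1}\}$ for $0\le i<k$, indices modulo $k$. For a family $\mathcal{F}$ of $r$-graphs, $\mathrm{ex}(n,\mathcal{F})$ is the maximum number of edges in an $n$-vertex $r$-graph containing no member of $\mathcal{F}$ as a subgraph. -}

module Defs where

open import Data.Nat using (ℕ; zero; suc; _+_; _*_; _∸_; _^_; _≤_)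
open import Data.Nat.DivMod using (_%_; m%n<n)
open import Data.Fin using (Fin; fromℕ<)
open import Data.Fin.Subset using (Subset; ⁅_⁆; _∪_; ∣_∣; ⊥)
open import Data.List using (List; length)
open import Data.List.Relation.Unary.All using (All)
open import Data.List.Relation.Unary.Unique.Propositional using (Unique)
open import Data.List.Membership.Propositional using (_∈_)
open import Data.Product using (Σ; _×_)
open import Relation.Binary.PropositionalEquality using (_≡_)
open import Relation.Nullary using (¬_)
open import Data.Empty renaming (⊥ to ⊥₀)
open import Function.Definitions using (Injective)

record RGraph (r n : ℕ) : Set where
  field
    edges   : List (Subset n)
    unique  : Unique edges
    uniform : All (λ e → ∣ e ∣ ≡ r) edges
open RGraph public

e : ∀ {r n} → RGraph r n → ℕ
e H = length (edges H)

cycVertex : ∀ {n} (m : ℕ) → (Fin (suc m) → Fin n) → ℕ → Fin n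
cycVertex m f x = f (fromℕ< (m%n<n x (suc m)))

window : ∀ {n} (m : ℕ) → (Fin (suc m) → Fin n) → ℕ → ℕ → Subset n
window m f i zero    = ⊥
window m f i (suc j) = ⁅ cycVertex m f (i + j) ⁆ ∪ window m f i j

ContainsTC : ∀ {r n} → RGraph r n → ℕ → Set
ContainsTC {r} {n} H zero = ⊥₀ -- k = 0 never occurs (k ≥ r+1)
ContainsTC {r} {n} H (suc m) =
  Σ (Fin (suc m) → Fin n) λ u →
    Injective _≡_ _≡_ u × (∀ (i : Fin (suc m)) → window m u (Data.Fin.toℕ i) r ∈ edges H)

TCFree : ∀ {r n} → (ℓ : ℕ) → RGraph r n → Set
TCFree {r} ℓ H = ∀ k → suc r ≤ k → k ≤ ℓ * r → ¬ ContainsTC H k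

{-# OPTIONS --safe #-}

-- Let G be a bipartite graph with sides V₀, V₁ of size p^ℓ, every vertex of V₀ having p neighbours, and without
-- closed non-backtracking walks of length 4, 6, …, 2ℓ. Add parts V₂, …, V₍ᵣ₋₁₎ of size p^ℓ and take all transversal
-- r-sets whose members in V₀ and V₁ are adjacent in G; there are p^(ℓ(r-1)+1) of them. Along a tight cycle each part
-- recurs with period r, so the cycle has length qr and its vertices in V₀ and V₁ alternate along a closed
-- non-backtracking walk of length 2q in G; hence q > ℓ.
--
-- In G the vertex y ∈ F_p^ℓ is adjacent to (a, y₁ - a y₀, y₂ - a² y₀, y₃ - a³ y₀, y₄ - y₀⟨y, a⟩), a ∈ F_p, truncated to
-- ℓ coordinates, where ⟨y, a⟩ is the symplectic pairing of (y₀, …, y₃) with (1, a, a², a³) normalised by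
-- ⟨(1, b, b², b³), a⟩ = (b - a)³; for ℓ = 5 this is the affine part of a generalised hexagon. A closed walk with
-- parameters aⱼ and increments cⱼ of y₀ satisfies Σ cⱼ aⱼⁱ = 0 for i < min(ℓ, 4) and, if ℓ = 5,
-- Σ_{i<j} cᵢ cⱼ (aᵢ - aⱼ)³ = 0, which is impossible for at most ℓ terms with cⱼ ≠ 0 and aⱼ ≠ aⱼ₊₁ cyclically.
--
-- The prime p is taken from an interval (4^t, 4^(t+11)]: if that contained no prime, every k ≤ 4^(t+11) would divide a
-- number too small to be a multiple of a large central binomial coefficient.
module Submission where

open import Defs
open import Algebra.Bundles using (CommutativeRing)
open import Algebra.Solver.Ring.AlmostCommutativeRing using (AlmostCommutativeRing; fromCommutativeRing; _-Raw-AlmostCommutative⟶_)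
import Algebra.Solver.Ring as RingSolver
open import Data.Empty using (⊥; ⊥-elim)
open import Data.Fin.Base using (Fin; zero; suc; toℕ; fromℕ<; inject≤; combine; remQuot; finToFun; funToFin)
open import Data.Fin.Properties using (toℕ<n; toℕ-injective; toℕ-fromℕ<; fromℕ<-cong; fromℕ<-injective;
  inject≤-injective; combine-injective; combine-remQuot; finToFun-funToFin; funToFin-finToFin)
open import Data.Integer.Base using (ℤ; 0ℤ)
import Data.Integer.Properties as ℤP
open import Data.Maybe.Base as Maybe using (Maybe)
open import Data.Nat.Base as ℕ using (ℕ; zero; suc)
import Data.Nat.Divisibility as ℕD
open import Data.Nat.Primality using (Prime; prime?; euclidsLemma; prime⇒nonZero; prime⇒nonTrivial; prime⇒irreducible; ¬prime[1])
import Data.Nat.Properties as ℕP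
open import Data.Product using (Σ; ∃; _×_; _,_; proj₁; proj₂)
open import Data.Sum using (_⊎_; inj₁; inj₂)
open import Function.Base using (_∘_)
open import Level using (0ℓ)
import Relation.Binary.Reasoning.Setoid as SetoidReasoning
open import Relation.Binary.PropositionalEquality as ≡ using (_≡_; _≢_)
open import Relation.Nullary using (¬_; yes; no)
open import Relation.Nullary.Decidable using (dec⇒maybe; _×-dec_)

-- Cubic relations in an integral domain

NoZeroDivisors : CommutativeRing 0ℓ 0ℓ → Set
NoZeroDivisors R = ∀ {x y} → x * y ≈ 0# → x ≈ 0# ⊎ y ≈ 0#
  where open CommutativeRing R

-- In the application the carrier is ℤ with congruence modulo p as equality. The solver takes its
-- coefficients from ℤ through `ℤ⟶R`, because equality is decidable there.
module IntegralDomain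
  (R : CommutativeRing 0ℓ 0ℓ)
  (ℤ⟶R : AlmostCommutativeRing.rawRing (fromCommutativeRing ℤP.+-*-commutativeRing)
         -Raw-AlmostCommutative⟶ fromCommutativeRing R)
  (integral : NoZeroDivisors R)
  where

  open CommutativeRing R
  open SetoidReasoning setoid

  private
    _≟ᶜ_ : ∀ x y → Maybe _
    x ≟ᶜ y = Maybe.map (λ eq → reflexive (≡.cong (_-Raw-AlmostCommutative⟶_.⟦_⟧ ℤ⟶R) eq)) (dec⇒maybe (x ℤP.≟ y))

  open RingSolver _ (fromCommutativeRing R) ℤ⟶R _≟ᶜ_

  ∸-cong : ∀ {x y u v} → x ≈ y → u ≈ v → x - u ≈ y - v
  ∸-cong d e = +-cong d (-‿cong e)

  x*0 : ∀ x {u} → u ≈ 0# → x * u ≈ 0#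
  x*0 x d = trans (*-congˡ d) (zeroʳ x)

  0*x : ∀ {x} u → x ≈ 0# → x * u ≈ 0#
  0*x u d = trans (*-congʳ d) (zeroˡ u)

  x≈y⇒x-y≈0 : ∀ {x y} → x ≈ y → x - y ≈ 0#
  x≈y⇒x-y≈0 {y = y} d = trans (+-congʳ d) (-‿inverseʳ y)

  x-y≈0⇒x≈y : ∀ {x y} → x - y ≈ 0# → x ≈ y
  x-y≈0⇒x≈y {x} {y} d = begin
    x           ≈⟨ solve 2 (λ x y → x := (x :- y) :+ y) refl x y ⟩
    (x - y) + y ≈⟨ +-congʳ d ⟩
    0# + y      ≈⟨ +-identityˡ y ⟩
    y           ∎

  +-cancelˡ-0 : ∀ {x u} → x ≈ 0# → x + u ≈ 0# → u ≈ 0#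
  +-cancelˡ-0 {x} {u} d e = trans (sym (trans (+-congʳ d) (+-identityˡ u))) e

  +-cancelʳ-0 : ∀ {x u} → u ≈ 0# → x + u ≈ 0# → x ≈ 0#
  +-cancelʳ-0 {x} {u} d e = trans (sym (trans (+-congˡ d) (+-identityʳ x))) e

  *-cancelˡ-0 : ∀ {x y} → ¬ x ≈ 0# → x * y ≈ 0# → y ≈ 0#
  *-cancelˡ-0 nx h with integral h
  ... | inj₁ k = ⊥-elim (nx k)
  ... | inj₂ k = k

  *-cancelʳ-0 : ∀ {x y} → ¬ y ≈ 0# → x * y ≈ 0# → x ≈ 0#
  *-cancelʳ-0 ny h with integral h
  ... | inj₁ k = k
  ... | inj₂ k = ⊥-elim (ny k)

  ≉0-* : ∀ {x y} → ¬ x ≈ 0# → ¬ y ≈ 0# → ¬ x * y ≈ 0#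
  ≉0-* nx ny h = ny (*-cancelˡ-0 nx h)

  cube : Carrier → Carrier
  cube x = x * x * x

  cube-cong : ∀ {x y} → x ≈ y → cube x ≈ cube y
  cube-cong d = *-cong (*-cong d d) d

  -- Sums run over 0, …, n, so that no literal zero enters the solver.
  sum : (ℕ → Carrier) → ℕ → Carrier
  sum f zero    = f 0
  sum f (suc n) = sum f n + f (suc n)

  sum-cong : ∀ {f g} → (∀ j → f j ≈ g j) → ∀ n → sum f n ≈ sum g n
  sum-cong h zero    = h 0
  sum-cong h (suc n) = +-cong (sum-cong h n) (h (suc n))

  sum-telescope : ∀ (f : ℕ → Carrier) n → sum (λ j → f (suc j) - f j) n ≈ f (suc n) - f 0
  sum-telescope f zero    = refl
  sum-telescope f (suc n) = trans (+-congʳ (sum-telescope f n))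
    (solve 3 (λ x y z → (y :- z) :+ (x :- y) := x :- z) refl (f (suc (suc n))) (f (suc n)) (f 0))

  sum-+ : ∀ f g n → sum (λ j → f j + g j) n ≈ sum f n + sum g n
  sum-+ f g zero    = refl
  sum-+ f g (suc n) = trans (+-congʳ (sum-+ f g n))
    (solve 4 (λ x y z w → (x :+ y) :+ (z :+ w) := (x :+ z) :+ (y :+ w)) refl (sum f n) (sum g n) (f (suc n)) (g (suc n)))

  sum-* : ∀ u f n → sum (λ j → u * f j) n ≈ u * sum f n
  sum-* u f zero    = refl
  sum-* u f (suc n) = trans (+-congʳ (sum-* u f n)) (sym (distribˡ u (sum f n) (f (suc n))))

  sum-shift : ∀ (f : ℕ → Carrier) n → sum (f ∘ suc) n + f 0 ≈ sum f n + f (suc n)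
  sum-shift f zero    = +-comm (f 1) (f 0)
  sum-shift f (suc n) = begin
    sum (f ∘ suc) n + f (2 ℕ.+ n) + f 0   ≈⟨ solve 3 (λ x y z → (x :+ y) :+ z := (x :+ z) :+ y) refl _ _ _ ⟩
    (sum (f ∘ suc) n + f 0) + f (2 ℕ.+ n) ≈⟨ +-congʳ (sum-shift f n) ⟩
    sum f (suc n) + f (2 ℕ.+ n)           ∎

  sum-rotate : ∀ (f : ℕ → Carrier) n → f (suc n) ≈ f 0 → sum (f ∘ suc) n ≈ sum f n
  sum-rotate f n eq = x-y≈0⇒x≈y (begin
    sum (f ∘ suc) n - sum f n                 ≈⟨ solve 3 (λ x y z → x :- y := (x :+ z) :- (y :+ z)) refl _ _ (f 0) ⟩
    (sum (f ∘ suc) n + f 0) - (sum f n + f 0) ≈⟨ ∸-cong (sum-shift f n) refl ⟩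
    (sum f n + f (suc n)) - (sum f n + f 0)   ≈⟨ x≈y⇒x-y≈0 (+-congˡ eq) ⟩
    0#                                        ∎)

  cubic : Carrier → Carrier → Carrier → Carrier → Carrier
  cubic α β γ x = (x - α) * (x - β) * (x - γ)

  cubic-root₁ : ∀ {α β γ x} → x ≈ α → cubic α β γ x ≈ 0#
  cubic-root₁ d = 0*x _ (0*x _ (x≈y⇒x-y≈0 d))

  cubic-root₂ : ∀ {α β γ x} → x ≈ β → cubic α β γ x ≈ 0#
  cubic-root₂ d = 0*x _ (x*0 _ (x≈y⇒x-y≈0 d))

  cubic-root₃ : ∀ {α β γ x} → x ≈ γ → cubic α β γ x ≈ 0#
  cubic-root₃ d = x*0 _ (x≈y⇒x-y≈0 d)

  -- The moment equations are stored as tests against monic cubics, since roots placed at chosen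
  -- `a j` delete chosen terms. There are `n + 1` terms; periodic sequences turn cyclic rotation
  -- into a shift of the index.
  record CubicRelation (n : ℕ) (c a : ℕ → Carrier) : Set where
    field
      vanish     : ∀ α β γ → sum (λ j → c j * cubic α β γ (a j)) n ≈ 0#
      c≉0        : ∀ j → ¬ c j ≈ 0#
      a-distinct : ∀ j → ¬ a j ≈ a (suc j)
      c-periodic : ∀ j → c (j ℕ.+ suc n) ≡ c j
      a-periodic : ∀ j → a (j ℕ.+ suc n) ≡ a j

  rotate : ∀ {n c a} → CubicRelation n c a → CubicRelation n (c ∘ suc) (a ∘ suc)
  rotate {n} {c} {a} rel = record
    { vanish = λ α β γ → trans (sum-rotate _ n
        (reflexive (≡.cong₂ (λ u x → u * cubic α β γ x) (c-periodic 0) (a-periodic 0)))) (vanish α β γ)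
    ; c≉0 = c≉0 ∘ suc
    ; a-distinct = a-distinct ∘ suc
    ; c-periodic = c-periodic ∘ suc
    ; a-periodic = a-periodic ∘ suc
    }
    where open CubicRelation rel

  -- This is Σ cᵢ cⱼ (aᵢ - aⱼ)³ over i < j ≤ n + 1. The outer index skips the empty inner sum at j =
  -- 0, so the argument `n` covers `n + 2` terms.
  heisenberg : (c a : ℕ → Carrier) → ℕ → Carrier
  heisenberg c a n = sum (λ j → c (suc j) * sum (λ i → c i * cube (a i - a (suc j))) j) n

  -- Relations with four terms

  module _ {c a : ℕ → Carrier} (rel : CubicRelation 3 c a) where
    open CubicRelation rel

    -- The cubic with roots `a 1`, `a 2`, `a 3` leaves only the term of `c 0`, and two of its three
    -- factors are nonzero because cyclic neighbours differ.
    four-a₀≈a₂ : a 0 ≈ a 2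
    four-a₀≈a₂ = x-y≈0⇒x≈y
      (*-cancelˡ-0 (a-distinct 0 ∘ x-y≈0⇒x≈y)
      (*-cancelʳ-0 (λ d → a-distinct 3 (trans (sym (x-y≈0⇒x≈y d)) (sym (reflexive (a-periodic 0)))))
      (*-cancelˡ-0 (c≉0 0)
      (+-cancelʳ-0 (x*0 (c 1) (cubic-root₁ refl))
      (+-cancelʳ-0 (x*0 (c 2) (cubic-root₂ refl))
      (+-cancelʳ-0 (x*0 (c 3) (cubic-root₃ refl))
        (vanish (a 1) (a 2) (a 3))))))))

  module _ {c a : ℕ → Carrier} (rel : CubicRelation 3 c a) where
    open CubicRelation rel

    -- By rotation `a 1 ≈ a 3`, so the cubic with triple root `a 1` deletes both odd terms; at `a 0`
    -- and `a 2` it takes the same nonzero value.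
    four-c₀+c₂≈0 : c 0 + c 2 ≈ 0#
    four-c₀+c₂≈0 = *-cancelʳ-0 (≉0-* (≉0-* nd nd) nd)
      (begin
        (c 0 + c 2) * f (a 0)                         ≈⟨ distribʳ _ _ _ ⟩
        c 0 * f (a 0) + c 2 * f (a 0)                 ≈⟨ +-cong (sym (+-identityʳ _)) (*-congˡ (cube-cong (+-congʳ (four-a₀≈a₂ rel)))) ⟩
        c 0 * f (a 0) + 0# + c 2 * f (a 2)            ≈⟨ +-congʳ (+-congˡ (sym (x*0 (c 1) (cubic-root₁ refl)))) ⟩
        c 0 * f (a 0) + c 1 * f (a 1) + c 2 * f (a 2) ≈⟨ +-cancelʳ-0 (x*0 (c 3) (cubic-root₁ (sym (four-a₀≈a₂ (rotate rel))))) (vanish (a 1) (a 1) (a 1)) ⟩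
        0#                                            ∎)
      where
      nd : ¬ a 0 - a 1 ≈ 0#
      nd = a-distinct 0 ∘ x-y≈0⇒x≈y
      f = cubic (a 1) (a 1) (a 1)

    four-c₂≈-c₀ : c 2 ≈ - c 0
    four-c₂≈-c₀ = begin
      c 2               ≈⟨ solve 2 (λ u v → v := (u :+ v) :- u) refl (c 0) (c 2) ⟩
      (c 0 + c 2) - c 0 ≈⟨ ∸-cong four-c₀+c₂≈0 refl ⟩
      0# - c 0          ≈⟨ +-identityˡ _ ⟩
      - c 0             ∎

  module _ {c a : ℕ → Carrier} (rel : CubicRelation 3 c a) (x+x≈0⇒x≈0 : ∀ {x} → x + x ≈ 0# → x ≈ 0#) where
    open CubicRelation rel

    -- The relation has collapsed to parameters a₀, a₁, a₀, a₁ with coefficients c₀, c₁, -c₀, -c₁.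
    -- On these the form equals 2 c₀ c₁ (a₀ - a₁)³.
    four-heisenberg≉0 : ¬ heisenberg c a 2 ≈ 0#
    four-heisenberg≉0 h = ≉0-* (≉0-* (c≉0 0) (c≉0 1)) (≉0-* (≉0-* nd nd) nd) (x+x≈0⇒x≈0 (begin
      c 0 * c 1 * cube (a 0 - a 1) + c 0 * c 1 * cube (a 0 - a 1)
        ≈⟨ solve 4 (λ c₀ c₁ a₀ a₁ → let cb = λ x → x :* x :* x in
             c₀ :* c₁ :* cb (a₀ :- a₁) :+ c₀ :* c₁ :* cb (a₀ :- a₁) :=
             c₁ :* (c₀ :* cb (a₀ :- a₁))
             :+ (:- c₀) :* (c₀ :* cb (a₀ :- a₀) :+ c₁ :* cb (a₁ :- a₀))
             :+ (:- c₁) :* (c₀ :* cb (a₀ :- a₁) :+ c₁ :* cb (a₁ :- a₁) :+ (:- c₀) :* cb (a₀ :- a₁)))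
             refl (c 0) (c 1) (a 0) (a 1) ⟩
      c 1 * (c 0 * cube (a 0 - a 1))
      + (- c 0) * (c 0 * cube (a 0 - a 0) + c 1 * cube (a 1 - a 0))
      + (- c 1) * (c 0 * cube (a 0 - a 1) + c 1 * cube (a 1 - a 1) + (- c 0) * cube (a 0 - a 1))
        ≈⟨ +-cong (+-cong refl (*-cong (sym c₂) (+-cong (x*cube refl a₂) (x*cube refl a₂))))
             (*-cong (sym c₃) (+-cong (+-cong (x*cube refl a₃) (x*cube refl a₃)) (*-cong (sym c₂) (cube-cong (∸-cong a₂ a₃))))) ⟩
      heisenberg c a 2 ≈⟨ h ⟩
      0# ∎))
      where
      a₂ = four-a₀≈a₂ rel
      a₃ = four-a₀≈a₂ (rotate rel)
      c₂ = four-c₂≈-c₀ rel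
      c₃ = four-c₂≈-c₀ (rotate rel)
      nd : ¬ a 0 - a 1 ≈ 0#
      nd = a-distinct 0 ∘ x-y≈0⇒x≈y
      x*cube : ∀ {c x y u v} → x ≈ u → y ≈ v → c * cube (x - y) ≈ c * cube (u - v)
      x*cube d e = *-congˡ (cube-cong (∸-cong d e))

  -- Relations with five terms

  module _ {c a : ℕ → Carrier} (rel : CubicRelation 4 c a) where
    open CubicRelation rel

    -- If a₀ = a₂, the cubic with roots a₀, a₁, a₃ isolates the last term and forces a₄ = a₁. The
    -- roots a₀, a₁, a₀ then isolate the term of `c 3` and force a₃ = a₁ = a₄, although a₃ and a₄
    -- are neighbours.
    five-a₀≉a₂ : ¬ a 0 ≈ a 2
    five-a₀≉a₂ d = a₃≉a₁ (x-y≈0⇒x≈y (*-cancelˡ-0 (a₃≉a₀ ∘ x-y≈0⇒x≈y) (*-cancelʳ-0 (a₃≉a₀ ∘ x-y≈0⇒x≈y)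
      (*-cancelˡ-0 (c≉0 3)
      (+-cancelˡ-0 (+-0 (+-0 (x*0 (c 0) (cubic-root₁ refl)) (x*0 (c 1) (cubic-root₂ refl))) (x*0 (c 2) (cubic-root₁ (sym d))))
      (+-cancelʳ-0 (x*0 (c 4) (cubic-root₂ a₄≈a₁))
        (vanish (a 0) (a 1) (a 0))))))))
      where
      +-0 : ∀ {x y} → x ≈ 0# → y ≈ 0# → x + y ≈ 0#
      +-0 h k = trans (+-cong h k) (+-identityˡ 0#)
      a₄≉a₀ : ¬ a 4 ≈ a 0
      a₄≉a₀ h = a-distinct 4 (trans h (sym (reflexive (a-periodic 0))))
      a₄≈a₁ : a 4 ≈ a 1
      a₄≈a₁ = x-y≈0⇒x≈y (*-cancelˡ-0 (a₄≉a₀ ∘ x-y≈0⇒x≈y) (*-cancelʳ-0 (a-distinct 3 ∘ sym ∘ x-y≈0⇒x≈y)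
        (*-cancelˡ-0 (c≉0 4)
        (+-cancelˡ-0 (+-0 (+-0 (+-0 (x*0 (c 0) (cubic-root₁ refl)) (x*0 (c 1) (cubic-root₂ refl)))
           (x*0 (c 2) (cubic-root₁ (sym d)))) (x*0 (c 3) (cubic-root₃ refl)))
          (vanish (a 0) (a 1) (a 3))))))
      a₃≉a₀ : ¬ a 3 ≈ a 0
      a₃≉a₀ h = a-distinct 2 (trans (sym d) (sym h))
      a₃≉a₁ : ¬ a 3 ≈ a 1
      a₃≉a₁ h = a-distinct 3 (trans h (sym a₄≈a₁))

  -- Eliminating c₀, c₁, c₃, c₄ in favour of c₂ by means of the four relations turns the
  -- quadratic form into a product of differences; x, y, z, w stand for a₀ - a₂, a₁ - a₂, a₃ - a₂, a₄ - a₂.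
  five-elimination : ∀ {c₀ c₁ c₂ c₃ c₄ x y z w} →
    c₀ * ((x - y) * ((x - z) * (x - w))) ≈ c₂ * (y * z * w) →
    c₁ * ((y - x) * ((y - z) * (y - w))) ≈ c₂ * (x * z * w) →
    c₃ * ((z - w) * ((z - x) * (z - y))) ≈ c₂ * (w * x * y) →
    c₄ * ((w - z) * ((w - x) * (w - y))) ≈ c₂ * (z * x * y) →
    c₀ * c₁ * cube (x - y) + c₂ * (c₀ * cube x + c₁ * cube y) + c₃ * c₄ * cube (z - w) ≈ 0# →
    let t = (c₂ * c₂) * ((x - y) * (z - w)) * (x * y * z * w) * (y * z * (w - x)) in t + t ≈ 0#
  five-elimination {c₀} {c₁} {c₂} {c₃} {c₄} {x} {y} {z} {w} h₀ h₁ h₃ h₄ h = begin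
    t + t
      ≈⟨ solve 5 (λ c₂ x y z w →
           let t′ = (c₂ :* c₂) :* ((x :- y) :* (z :- w)) :* (x :* y :* z :* w) :* (y :* z :* (w :- x)) in
           t′ :+ t′ :=
           :- ((c₂ :* (y :* z :* w)) :* (c₂ :* (x :* z :* w)) :* ((x :- y) :* (x :- y) :* (z :- w)))
           :+ c₂ :* ((c₂ :* (y :* z :* w)) :* (x :* x :* x :* ((y :- z) :* (y :- w)))
                :- (c₂ :* (x :* z :* w)) :* (y :* y :* y :* ((x :- z) :* (x :- w)))) :* (z :- w)
           :- (c₂ :* (w :* x :* y)) :* (c₂ :* (z :* x :* y)) :* ((z :- w) :* (z :- w) :* (x :- y)))
           refl c₂ x y z w ⟩
    - ((c₂ * (y * z * w)) * (c₂ * (x * z * w)) * ((x - y) * (x - y) * (z - w)))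
    + c₂ * ((c₂ * (y * z * w)) * (cube x * F) - (c₂ * (x * z * w)) * (cube y * E)) * (z - w)
    - (c₂ * (w * x * y)) * (c₂ * (z * x * y)) * ((z - w) * (z - w) * (x - y))
      ≈⟨ ∸-cong (+-cong (-‿cong (*-congʳ (*-cong (sym h₀) (sym h₁))))
           (*-congʳ (*-congˡ (∸-cong (*-congʳ (sym h₀)) (*-congʳ (sym h₁))))))
           (*-congʳ (*-cong (sym h₃) (sym h₄))) ⟩
    - ((c₀ * ((x - y) * E)) * (c₁ * ((y - x) * F)) * ((x - y) * (x - y) * (z - w)))
    + c₂ * ((c₀ * ((x - y) * E)) * (cube x * F) - (c₁ * ((y - x) * F)) * (cube y * E)) * (z - w)
    - (c₃ * ((z - w) * ((z - x) * (z - y)))) * (c₄ * ((w - z) * ((w - x) * (w - y)))) * ((z - w) * (z - w) * (x - y))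
      ≈⟨ +-cong (+-cong
           (solve 7 (λ c₀ c₁ x y E F Z →
              :- ((c₀ :* ((x :- y) :* E)) :* (c₁ :* ((y :- x) :* F)) :* ((x :- y) :* (x :- y) :* Z)) :=
              E :* F :* ((x :- y) :* Z) :* (c₀ :* c₁ :* ((x :- y) :* (x :- y) :* (x :- y)))) refl c₀ c₁ x y E F (z - w))
           (solve 8 (λ c₀ c₁ c₂ x y E F Z →
              c₂ :* ((c₀ :* ((x :- y) :* E)) :* (x :* x :* x :* F) :- (c₁ :* ((y :- x) :* F)) :* (y :* y :* y :* E)) :* Z :=
              E :* F :* ((x :- y) :* Z) :* (c₂ :* (c₀ :* (x :* x :* x) :+ c₁ :* (y :* y :* y)))) refl c₀ c₁ c₂ x y E F (z - w)))
           (solve 7 (λ c₃ c₄ x y z w X →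
              :- ((c₃ :* ((z :- w) :* ((z :- x) :* (z :- y)))) :* (c₄ :* ((w :- z) :* ((w :- x) :* (w :- y)))) :* ((z :- w) :* (z :- w) :* X)) :=
              ((x :- z) :* (x :- w)) :* ((y :- z) :* (y :- w)) :* (X :* (z :- w)) :* (c₃ :* c₄ :* ((z :- w) :* (z :- w) :* (z :- w))))
              refl c₃ c₄ x y z w (x - y)) ⟩
    m * (c₀ * c₁ * cube (x - y)) + m * (c₂ * (c₀ * cube x + c₁ * cube y)) + m * (c₃ * c₄ * cube (z - w))
      ≈⟨ solve 4 (λ m u v s → m :* u :+ m :* v :+ m :* s := m :* (u :+ v :+ s)) refl m _ _ _ ⟩
    m * (c₀ * c₁ * cube (x - y) + c₂ * (c₀ * cube x + c₁ * cube y) + c₃ * c₄ * cube (z - w))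
      ≈⟨ x*0 _ h ⟩
    0# ∎
    where
    E = (x - z) * (x - w)
    F = (y - z) * (y - w)
    -- Up to sign, `m` is the product of all six differences of `x`, `y`, `z`, `w`. After
    -- multiplication by it, every term of the quadratic form contains left-hand sides of the four
    -- relations as factors.
    m = E * F * ((x - y) * (z - w))
    t = (c₂ * c₂) * ((x - y) * (z - w)) * (x * y * z * w) * (y * z * (w - x))

  -- Brings a relation with two surviving terms into the shape of the hypotheses of
  -- `five-elimination`, with all parameters translated by t = a₂.
  cubic-pair : ∀ {u v s t α β γ} → u * cubic α β γ s + v * cubic α β γ t ≈ 0# →
    u * (((s - t) - (α - t)) * (((s - t) - (β - t)) * ((s - t) - (γ - t)))) ≈ v * ((α - t) * (β - t) * (γ - t))
  cubic-pair {u} {v} {s} {t} {α} {β} {γ} h = x-y≈0⇒x≈y (trans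
    (solve 7 (λ u v s t α β γ →
       u :* (((s :- t) :- (α :- t)) :* (((s :- t) :- (β :- t)) :* ((s :- t) :- (γ :- t))))
         :- v :* ((α :- t) :* (β :- t) :* (γ :- t)) :=
       u :* ((s :- α) :* (s :- β) :* (s :- γ)) :+ v :* ((t :- α) :* (t :- β) :* (t :- γ))) refl u v s t α β γ)
    h)

  module _ {c a : ℕ → Carrier} (rel : CubicRelation 4 c a) (x+x≈0⇒x≈0 : ∀ {x} → x + x ≈ 0# → x ≈ 0#) where
    open CubicRelation rel

    private
      x = a 0 - a 2
      y = a 1 - a 2
      z = a 3 - a 2
      w = a 4 - a 2

      difference : ∀ {s t} → (s - a 2) - (t - a 2) ≈ s - t
      difference {s} {t} = solve 3 (λ s t u → (s :- u) :- (t :- u) := s :- t) refl s t (a 2)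

      -- The products pairing an index in {0, 1, 2} with one in {3, 4} are removed by subtracting
      -- the cubic relations with triple roots a₃ and a₄. The term of the pair (3, 4) is thereby
      -- subtracted in both orders; these two contributions cancel since the cube is odd.
      quadratic-form : heisenberg c a 3 ≈ 0# →
        c 0 * c 1 * cube (x - y) + c 2 * (c 0 * cube x + c 1 * cube y) + c 3 * c 4 * cube (z - w) ≈ 0#
      quadratic-form h = begin
        c 0 * c 1 * cube (x - y) + c 2 * (c 0 * cube x + c 1 * cube y) + c 3 * c 4 * cube (z - w)
          ≈⟨ +-cong (+-congʳ (*-congˡ (cube-cong difference))) (*-congˡ (cube-cong difference)) ⟩
        c 0 * c 1 * cube (a 0 - a 1) + B + c 3 * c 4 * cube (a 3 - a 4)
          ≈⟨ solve 10 (λ c₀ c₁ c₃ c₄ K B P Q a₃ a₄ → let cb = λ u → u :* u :* u in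
               c₀ :* c₁ :* K :+ B :+ c₃ :* c₄ :* cb (a₃ :- a₄) :=
               (c₁ :* (c₀ :* K) :+ B :+ c₃ :* P :+ c₄ :* (Q :+ c₃ :* cb (a₃ :- a₄)))
               :- c₃ :* (P :+ c₃ :* cb (a₃ :- a₃) :+ c₄ :* cb (a₄ :- a₃))
               :- c₄ :* (Q :+ c₃ :* cb (a₃ :- a₄) :+ c₄ :* cb (a₄ :- a₄)))
               refl (c 0) (c 1) (c 3) (c 4) (cube (a 0 - a 1)) B P Q (a 3) (a 4) ⟩
        heisenberg c a 3 - c 3 * sum (f (a 3)) 4 - c 4 * sum (f (a 4)) 4
          ≈⟨ ∸-cong (∸-cong h (x*0 _ (vanish (a 3) (a 3) (a 3)))) (x*0 _ (vanish (a 4) (a 4) (a 4))) ⟩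
        0# - 0# - 0#
          ≈⟨ trans (∸-cong (-‿inverseʳ 0#) refl) (-‿inverseʳ 0#) ⟩
        0# ∎
        where
        f : Carrier → ℕ → Carrier
        f t j = c j * cube (a j - t)
        B = c 2 * (c 0 * cube x + c 1 * cube y)
        P = sum (f (a 3)) 2
        Q = sum (f (a 4)) 2

    -- Each of `h₀`, `h₁`, `h₃`, `h₄` places the three roots so that only one term besides that of
    -- `c 2` survives. The product from `five-elimination` has nonzero factors: neighbours differ,
    -- and `five-a₀≉a₂` with its rotation treats the pairs (0, 2) and (2, 4).
    five-heisenberg≉0 : ¬ heisenberg c a 3 ≈ 0#
    five-heisenberg≉0 h =
      ≉0-* (≉0-* (≉0-* (≉0-* (c≉0 2) (c≉0 2)) (≉0-* x-y≉0 z-w≉0)) (≉0-* (≉0-* (≉0-* x≉0 y≉0) z≉0) w≉0))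
           (≉0-* (≉0-* y≉0 z≉0) w-x≉0)
        (x+x≈0⇒x≈0 (five-elimination h₀ h₁ h₃ h₄ (quadratic-form h)))
      where
      kill₁ : ∀ {α β γ} j → a j ≈ α → c j * cubic α β γ (a j) ≈ 0#
      kill₁ j d = x*0 (c j) (cubic-root₁ d)
      kill₂ : ∀ {α β γ} j → a j ≈ β → c j * cubic α β γ (a j) ≈ 0#
      kill₂ j d = x*0 (c j) (cubic-root₂ d)
      kill₃ : ∀ {α β γ} j → a j ≈ γ → c j * cubic α β γ (a j) ≈ 0#
      kill₃ j d = x*0 (c j) (cubic-root₃ d)
      drop : ∀ {u v s} → v ≈ 0# → u + v + s ≈ 0# → u + s ≈ 0#
      drop d e = trans (+-congʳ (sym (trans (+-congˡ d) (+-identityʳ _)))) e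
      drop₂ : ∀ {s t u v} → s ≈ 0# → t ≈ 0# → s + t + u + v ≈ 0# → v + u ≈ 0#
      drop₂ {u = u} {v} d₁ d₂ eq = begin
        v + u      ≈⟨ +-comm v u ⟩
        u + v      ≈⟨ +-congʳ (trans (+-congʳ (trans (+-cong d₁ d₂) (+-identityˡ 0#))) (+-identityˡ u)) ⟨
        _ + u + v  ≈⟨ eq ⟩
        0#         ∎
      h₀ = cubic-pair {α = a 1} {a 3} {a 4} (drop (kill₁ 1 refl)
             (+-cancelʳ-0 (kill₂ 3 refl) (+-cancelʳ-0 (kill₃ 4 refl) (vanish (a 1) (a 3) (a 4)))))
      h₁ = cubic-pair {α = a 0} {a 3} {a 4} (trans (+-congʳ (sym (trans (+-congʳ (kill₁ 0 refl)) (+-identityˡ _))))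
             (+-cancelʳ-0 (kill₂ 3 refl) (+-cancelʳ-0 (kill₃ 4 refl) (vanish (a 0) (a 3) (a 4)))))
      h₃ = cubic-pair {α = a 4} {a 0} {a 1} (drop₂ (kill₂ 0 refl) (kill₃ 1 refl)
             (+-cancelʳ-0 (kill₁ 4 refl) (vanish (a 4) (a 0) (a 1))))
      h₄ = cubic-pair {α = a 3} {a 0} {a 1} (drop₂ (kill₂ 0 refl) (kill₃ 1 refl)
             (drop (kill₁ 3 refl) (vanish (a 3) (a 0) (a 1))))
      differ : ∀ {s t} → ¬ s ≈ t → ¬ (s - a 2) - (t - a 2) ≈ 0#
      differ n d = n (x-y≈0⇒x≈y (trans (sym difference) d))
      a₄≉a₀ : ¬ a 4 ≈ a 0
      a₄≉a₀ d = a-distinct 4 (trans d (sym (reflexive (a-periodic 0))))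
      x≉0 : ¬ x ≈ 0#
      x≉0 = five-a₀≉a₂ rel ∘ x-y≈0⇒x≈y
      y≉0 : ¬ y ≈ 0#
      y≉0 = a-distinct 1 ∘ x-y≈0⇒x≈y
      z≉0 : ¬ z ≈ 0#
      z≉0 = a-distinct 2 ∘ sym ∘ x-y≈0⇒x≈y
      w≉0 : ¬ w ≈ 0#
      w≉0 = five-a₀≉a₂ (rotate (rotate rel)) ∘ sym ∘ x-y≈0⇒x≈y
      x-y≉0 = differ (a-distinct 0)
      z-w≉0 = differ (a-distinct 3)
      w-x≉0 = differ a₄≉a₀

  -- Testing against the linear polynomial with root `a 1` isolates the first term.
  two-impossible : ∀ {c a : ℕ → Carrier} → sum c 1 ≈ 0# → sum (λ j → c j * a j) 1 ≈ 0# →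
    ¬ c 0 ≈ 0# → ¬ a 0 ≈ a 1 → ⊥
  two-impossible {c} {a} s₀ s₁ nc na = ≉0-* nc (na ∘ x-y≈0⇒x≈y) (begin
    c 0 * (a 0 - a 1)
      ≈⟨ solve 4 (λ c₀ c₁ a₀ a₁ → c₀ :* (a₀ :- a₁) := (c₀ :* a₀ :+ c₁ :* a₁) :- a₁ :* (c₀ :+ c₁)) refl (c 0) (c 1) (a 0) (a 1) ⟩
    sum (λ j → c j * a j) 1 - a 1 * sum c 1 ≈⟨ ∸-cong s₁ (x*0 _ s₀) ⟩
    0# - 0#                                 ≈⟨ -‿inverseʳ 0# ⟩
    0#                                      ∎)

  -- Testing against the quadratic with roots `a 1` and `a 2` isolates the first term.
  three-impossible : ∀ {c a : ℕ → Carrier} → sum c 2 ≈ 0# → sum (λ j → c j * a j) 2 ≈ 0# →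
    sum (λ j → c j * (a j * a j)) 2 ≈ 0# → ¬ c 0 ≈ 0# → ¬ a 0 ≈ a 1 → ¬ a 2 ≈ a 0 → ⊥
  three-impossible {c} {a} s₀ s₁ s₂ nc na na′ =
    ≉0-* (≉0-* nc (na ∘ x-y≈0⇒x≈y)) (na′ ∘ sym ∘ x-y≈0⇒x≈y) (begin
    c 0 * (a 0 - a 1) * (a 0 - a 2)
      ≈⟨ solve 6 (λ c₀ c₁ c₂ a₀ a₁ a₂ → c₀ :* (a₀ :- a₁) :* (a₀ :- a₂) :=
           (c₀ :* (a₀ :* a₀) :+ c₁ :* (a₁ :* a₁) :+ c₂ :* (a₂ :* a₂))
           :- (a₁ :+ a₂) :* (c₀ :* a₀ :+ c₁ :* a₁ :+ c₂ :* a₂)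
           :+ (a₁ :* a₂) :* (c₀ :+ c₁ :+ c₂)) refl (c 0) (c 1) (c 2) (a 0) (a 1) (a 2) ⟩
    sum (λ j → c j * (a j * a j)) 2 - (a 1 + a 2) * sum (λ j → c j * a j) 2 + (a 1 * a 2) * sum c 2
      ≈⟨ +-cong (∸-cong s₂ (x*0 _ s₁)) (x*0 _ s₀) ⟩
    0# - 0# + 0#  ≈⟨ trans (+-identityʳ _) (-‿inverseʳ 0#) ⟩
    0#            ∎)

  -- Lines, points and closed walks

  -- The value at b of the symplectic pairing of (y₀, y₁, y₂, y₃) with (1, b, b², b³); it sends (1, a, a², a³) to (a - b)³.
  pairing : (ℕ → Carrier) → Carrier → Carrier
  pairing y b = y 3 - (b * y 2 + b * y 2 + b * y 2) + (b * b * y 1 + b * b * y 1 + b * b * y 1) - b * b * b * y 0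

  point : ℕ → (ℕ → Carrier) → Carrier → Carrier
  point 0 y a = a
  point 1 y a = y 1 - a * y 0
  point 2 y a = y 2 - a * a * y 0
  point 3 y a = y 3 - a * a * a * y 0
  point (suc (suc (suc (suc _)))) y a = y 4 - pairing y a * y 0

  -- Here `s`, `t` are coordinates k and 0 of a line and `m` is its slope at a point shared with a
  -- second line. The two slopes are kept apart because for k = 4 they depend on the line.
  shear : ∀ {s s′ t t′ m m′} → m ≈ m′ → s - m * t ≈ s′ - m′ * t′ → s′ - s ≈ (t′ - t) * m
  shear {s} {s′} {t} {t′} {m} {m′} d h = x-y≈0⇒x≈y (begin
    s′ - s - (t′ - t) * m
      ≈⟨ solve 5 (λ s s′ t t′ m → s′ :- s :- (t′ :- t) :* m := (s′ :- m :* t′) :- (s :- m :* t)) refl s s′ t t′ m ⟩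
    (s′ - m * t′) - (s - m * t)
      ≈⟨ x≈y⇒x-y≈0 (trans (∸-cong refl (*-congʳ d)) (sym h)) ⟩
    0# ∎)

  -- By `shear`, equal coordinates 0 force equality of the others; coordinate 4 comes last, since
  -- its slope is a pairing of the first four. Consequently distinct lines through a point differ in
  -- coordinate 0.
  point-determines : ∀ {ℓ y y′ a} → ℓ ℕ.≤ 5 → (∀ k → k ℕ.< ℓ → point k y a ≈ point k y′ a) →
    y′ 0 ≈ y 0 → ∀ k → k ℕ.< ℓ → y′ k ≈ y k
  point-determines {ℓ} {y} {y′} {a} ℓ≤5 same d = agree
    where
    sheared : ∀ {k m m′} → m ≈ m′ → y k - m * y 0 ≈ y′ k - m′ * y′ 0 → y′ k ≈ y k
    sheared e h = x-y≈0⇒x≈y (trans (shear e h) (0*x _ (x≈y⇒x-y≈0 d)))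
    agree : ∀ k → k ℕ.< ℓ → y′ k ≈ y k
    agree 0 _  = d
    agree 1 lt = sheared refl (same 1 lt)
    agree 2 lt = sheared refl (same 2 lt)
    agree 3 lt = sheared refl (same 3 lt)
    agree 4 lt = sheared (sym pairing-agrees) (same 4 lt)
      where
      triple : ∀ {s t} → s ≈ t → s + s + s ≈ t + t + t
      triple e = +-cong (+-cong e e) e
      pairing-agrees : pairing y′ a ≈ pairing y a
      pairing-agrees = ∸-cong (+-cong (∸-cong
        (agree 3 (ℕP.<-trans (ℕP.n<1+n 3) lt))
        (triple (*-congˡ (agree 2 (ℕP.≤-trans (ℕ.s≤s (ℕ.s≤s (ℕ.s≤s ℕ.z≤n))) lt)))))
        (triple (*-congˡ (agree 1 (ℕP.≤-trans (ℕ.s≤s (ℕ.s≤s ℕ.z≤n)) lt)))))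
        (*-congˡ d)
    agree (suc (suc (suc (suc (suc k))))) lt with ℕP.≤-trans lt ℓ≤5
    ... | ℕ.s≤s (ℕ.s≤s (ℕ.s≤s (ℕ.s≤s (ℕ.s≤s ()))))

  -- A period has `n + 1` lines; `y j` and `y (suc j)` meet in the point with parameter `a j`.
  -- Distinctness of lines is stated in coordinate 0, where it makes the increments `c j` nonzero.
  record ClosedWalk (ℓ n : ℕ) : Set where
    field
      y          : ℕ → ℕ → Carrier
      a          : ℕ → Carrier
      incident   : ∀ j k → k ℕ.< ℓ → point k (y j) (a j) ≈ point k (y (suc j)) (a j)
      y-distinct : ∀ j → ¬ y (suc j) 0 ≈ y j 0
      a-distinct : ∀ j → ¬ a j ≈ a (suc j)
      y-periodic : ∀ j k → y (j ℕ.+ suc n) k ≡ y j k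
      a-periodic : ∀ j → a (j ℕ.+ suc n) ≡ a j

    c : ℕ → Carrier
    c j = y (suc j) 0 - y j 0

    a-wrap : ¬ a n ≈ a 0
    a-wrap d = a-distinct n (trans d (sym (reflexive (a-periodic 0))))

    sum-step : ∀ k (f : ℕ → Carrier) → (∀ j → y (suc j) k - y j k ≈ f j) → sum f n ≈ 0#
    sum-step k f h = begin
      sum f n                            ≈⟨ sum-cong h n ⟨
      sum (λ j → y (suc j) k - y j k) n  ≈⟨ sum-telescope (λ j → y j k) n ⟩
      y (suc n) k - y 0 k                ≈⟨ x≈y⇒x-y≈0 (reflexive (y-periodic 0 k)) ⟩
      0#                                 ∎

    moment₀ : sum c n ≈ 0#
    moment₀ = sum-step 0 c (λ _ → refl)

    step₁ : 1 ℕ.< ℓ → ∀ j → y (suc j) 1 - y j 1 ≈ c j * a j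
    step₁ lt j = shear refl (incident j 1 lt)

    step₂ : 2 ℕ.< ℓ → ∀ j → y (suc j) 2 - y j 2 ≈ c j * (a j * a j)
    step₂ lt j = shear refl (incident j 2 lt)

    step₃ : 3 ℕ.< ℓ → ∀ j → y (suc j) 3 - y j 3 ≈ c j * (a j * a j * a j)
    step₃ lt j = shear refl (incident j 3 lt)

    module _ (4<ℓ : 4 ℕ.< ℓ) where

      private
        S₁ = step₁ (ℕP.≤-trans (ℕ.s≤s (ℕ.s≤s ℕ.z≤n)) 4<ℓ)
        S₂ = step₂ (ℕP.≤-trans (ℕ.s≤s (ℕ.s≤s (ℕ.s≤s ℕ.z≤n))) 4<ℓ)
        S₃ = step₃ (ℕP.≤-trans (ℕ.s≤s (ℕ.s≤s (ℕ.s≤s (ℕ.s≤s ℕ.z≤n)))) 4<ℓ)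

      -- The pairing is linear in the line, and the step adds `c j` times (1, a, a², a³) for a =
      -- `a j`.
      pairing-step : ∀ j b → pairing (y (suc j)) b ≈ pairing (y j) b + c j * cube (a j - b)
      pairing-step j b = begin
        pairing (y (suc j)) b
          ≈⟨ solve 9 (λ b y₀ y₁ y₂ y₃ y₀′ y₁′ y₂′ y₃′ →
               y₃′ :- (b :* y₂′ :+ b :* y₂′ :+ b :* y₂′) :+ (b :* b :* y₁′ :+ b :* b :* y₁′ :+ b :* b :* y₁′) :- b :* b :* b :* y₀′ :=
               y₃ :- (b :* y₂ :+ b :* y₂ :+ b :* y₂) :+ (b :* b :* y₁ :+ b :* b :* y₁ :+ b :* b :* y₁) :- b :* b :* b :* y₀
               :+ (y₃′ :- y₃ :- (b :* (y₂′ :- y₂) :+ b :* (y₂′ :- y₂) :+ b :* (y₂′ :- y₂))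
                   :+ (b :* b :* (y₁′ :- y₁) :+ b :* b :* (y₁′ :- y₁) :+ b :* b :* (y₁′ :- y₁)) :- b :* b :* b :* (y₀′ :- y₀)))
               refl b (y j 0) (y j 1) (y j 2) (y j 3) (y (suc j) 0) (y (suc j) 1) (y (suc j) 2) (y (suc j) 3) ⟩
        pairing (y j) b + pairing (λ k → y (suc j) k - y j k) b
          ≈⟨ +-congˡ (+-congʳ (+-cong (∸-cong (S₃ j) (triple (*-congˡ (S₂ j)))) (triple (*-congˡ (S₁ j))))) ⟩
        pairing (y j) b
          + (C * (A * A * A) - (b * (C * (A * A)) + b * (C * (A * A)) + b * (C * (A * A)))
             + (b * b * (C * A) + b * b * (C * A) + b * b * (C * A)) - b * b * b * C)
          ≈⟨ +-congˡ (solve 3 (λ C A b →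
               C :* (A :* A :* A) :- (b :* (C :* (A :* A)) :+ b :* (C :* (A :* A)) :+ b :* (C :* (A :* A)))
               :+ (b :* b :* (C :* A) :+ b :* b :* (C :* A) :+ b :* b :* (C :* A)) :- b :* b :* b :* C :=
               C :* ((A :- b) :* (A :- b) :* (A :- b))) refl C A b) ⟩
        pairing (y j) b + C * cube (A - b) ∎
        where
        C = c j
        A = a j
        triple : ∀ {s t} → s ≈ t → s + s + s ≈ t + t + t
        triple d = +-cong (+-cong d d) d

      step₄ : ∀ j → y (suc j) 4 - y j 4 ≈ c j * pairing (y j) (a j)
      -- At b = `a j` the cube vanishes, so the two lines have the same slope at their common point.
      step₄ j = shear (sym (trans (pairing-step j (a j))
          (trans (+-congˡ (x*0 _ (x*0 _ (-‿inverseʳ (a j))))) (+-identityʳ _)))) (incident j 4 4<ℓ)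

      pairing-sum : ∀ j b → pairing (y (suc j)) b ≈ pairing (y 0) b + sum (λ i → c i * cube (a i - b)) j
      pairing-sum zero    b = pairing-step 0 b
      pairing-sum (suc j) b = trans (pairing-step (suc j) b) (trans (+-congʳ (pairing-sum j b)) (+-assoc _ _ _))

      -- General coefficients serve two purposes: the expansion of a cubic with given roots, and the
      -- pairing of the fixed line `y 0` with the varying `a j`.
      cubic-moments : ∀ u₀ u₁ u₂ u₃ →
        sum (λ j → u₀ * c j + u₁ * (c j * a j) + u₂ * (c j * (a j * a j)) + u₃ * (c j * (a j * a j * a j))) n ≈ 0#
      cubic-moments u₀ u₁ u₂ u₃ =
        add (λ j → u₀ * c j + u₁ * (c j * a j) + u₂ * (c j * (a j * a j))) (λ j → u₃ * (c j * (a j * a j * a j)))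
        (add (λ j → u₀ * c j + u₁ * (c j * a j)) (λ j → u₂ * (c j * (a j * a j)))
        (add (λ j → u₀ * c j) (λ j → u₁ * (c j * a j))
          (trans (sum-* u₀ c n) (x*0 _ moment₀))
          (trans (sum-* u₁ (λ j → c j * a j) n) (x*0 _ (sum-step 1 (λ j → c j * a j) S₁))))
          (trans (sum-* u₂ (λ j → c j * (a j * a j)) n) (x*0 _ (sum-step 2 (λ j → c j * (a j * a j)) S₂))))
          (trans (sum-* u₃ (λ j → c j * (a j * a j * a j)) n) (x*0 _ (sum-step 3 (λ j → c j * (a j * a j * a j)) S₃)))
        where
        add : ∀ f g → sum f n ≈ 0# → sum g n ≈ 0# → sum (λ j → f j + g j) n ≈ 0#
        add f g h k = trans (sum-+ f g n) (trans (+-cong h k) (+-identityˡ 0#))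

      cubicRelation : CubicRelation n c a
      cubicRelation = record
        { vanish = λ α β γ → trans (sum-cong (λ j →
            solve 5 (λ c a α β γ → c :* ((a :- α) :* (a :- β) :* (a :- γ)) :=
              :- (α :* β :* γ) :* c :+ (α :* β :+ β :* γ :+ α :* γ) :* (c :* a)
              :+ (:- (α :+ β :+ γ)) :* (c :* (a :* a)) :+ c :* (a :* a :* a)) refl (c j) (a j) α β γ) n)
            (trans (sum-cong (λ j → +-congˡ (sym (*-identityˡ _))) n)
            (cubic-moments (- (α * β * γ)) (α * β + β * γ + α * γ) (- (α + β + γ)) 1#))
        ; c≉0 = λ j → y-distinct j ∘ x-y≈0⇒x≈y
        ; a-distinct = a-distinct
        ; c-periodic = λ j → ≡.cong₂ _-_ (y-periodic (suc j) 0) (y-periodic j 0)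
        ; a-periodic = a-periodic
        }

    -- Coordinate 4 returns to its start, so Σ cⱼ⟨yⱼ, aⱼ⟩ = 0. By `pairing-sum`, ⟨yⱼ, aⱼ⟩ is ⟨y₀,
    -- aⱼ⟩ plus the inner sum of the form, and the contribution of ⟨y₀, aⱼ⟩ vanishes by
    -- `cubic-moments`.
    heisenberg≈0 : 4 ℕ.< ℓ → ∀ {m} → n ≡ suc m → heisenberg c a m ≈ 0#
    heisenberg≈0 4<ℓ {m} ≡.refl = +-cancelˡ-0 (x*0 1# (cubic-moments 4<ℓ (y 0 3) u₁ u₂ (- y 0 0))) (begin
      1# * sum g n + heisenberg c a m
        ≈⟨ +-congʳ (trans (*-identityˡ _) (sum-cong (λ j → solve 6 (λ c a y₀ y₁ y₂ y₃ →
             y₃ :* c :+ (:- (y₂ :+ y₂ :+ y₂)) :* (c :* a) :+ (y₁ :+ y₁ :+ y₁) :* (c :* (a :* a)) :+ (:- y₀) :* (c :* (a :* a :* a)) :=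
             c :* (y₃ :- (a :* y₂ :+ a :* y₂ :+ a :* y₂) :+ (a :* a :* y₁ :+ a :* a :* y₁ :+ a :* a :* y₁) :- a :* a :* a :* y₀))
             refl (c j) (a j) (y 0 0) (y 0 1) (y 0 2) (y 0 3)) n)) ⟩
      sum p n + heisenberg c a m
        ≈⟨ +-congʳ (sum-shift p m) ⟨
      sum (p ∘ suc) m + p 0 + heisenberg c a m
        ≈⟨ solve 3 (λ u v w → u :+ v :+ w := (u :+ w) :+ v) refl _ _ _ ⟩
      sum (p ∘ suc) m + heisenberg c a m + p 0
        ≈⟨ +-congʳ (sum-+ (p ∘ suc) (λ j → c (suc j) * sum (λ i → c i * cube (a i - a (suc j))) j) m) ⟨
      sum (λ j → c (suc j) * pairing (y 0) (a (suc j)) + c (suc j) * sum (λ i → c i * cube (a i - a (suc j))) j) m + p 0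
        ≈⟨ +-congʳ (sum-cong (λ j → trans (sym (distribˡ _ _ _)) (*-congˡ (sym (pairing-sum 4<ℓ j (a (suc j)))))) m) ⟩
      sum (λ j → c (suc j) * pairing (y (suc j)) (a (suc j))) m + p 0
        ≈⟨ sum-shift (λ j → c j * pairing (y j) (a j)) m ⟩
      sum (λ j → c j * pairing (y j) (a j)) n
        ≈⟨ sum-step 4 (λ j → c j * pairing (y j) (a j)) (step₄ 4<ℓ) ⟩
      0# ∎)
      where
      u₁ = - (y 0 2 + y 0 2 + y 0 2)
      u₂ = y 0 1 + y 0 1 + y 0 1
      g = λ j → y 0 3 * c j + u₁ * (c j * a j) + u₂ * (c j * (a j * a j)) + (- y 0 0) * (c j * (a j * a j * a j))
      p = λ j → c j * pairing (y 0) (a j)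

  module _ (x+x≈0⇒x≈0 : ∀ {x} → x + x ≈ 0# → x ≈ 0#) where

    -- Two or three lines are excluded by power moments alone. Four or five lines occur only for ℓ =
    -- 5, where the cubic moments contradict the vanishing of the Heisenberg form.
    no-closedWalk : ∀ {ℓ n} → ℓ ≡ 2 ⊎ ℓ ≡ 3 ⊎ ℓ ≡ 5 → 1 ℕ.≤ n → n ℕ.< ℓ → ¬ ClosedWalk ℓ n
    no-closedWalk {ℓ} {1} _ _ 1<ℓ W =
      two-impossible {c = c} {a} moment₀ (sum-step 1 _ (step₁ 1<ℓ)) (y-distinct 0 ∘ x-y≈0⇒x≈y) (a-distinct 0)
      where open ClosedWalk W
    no-closedWalk {ℓ} {2} _ _ 2<ℓ W =
      three-impossible {c = c} {a} moment₀ (sum-step 1 _ (step₁ (ℕP.<-trans (ℕP.n<1+n 1) 2<ℓ)))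
        (sum-step 2 _ (step₂ 2<ℓ)) (y-distinct 0 ∘ x-y≈0⇒x≈y) (a-distinct 0) a-wrap
      where open ClosedWalk W
    no-closedWalk {n = suc (suc (suc _))} (inj₁ ≡.refl) _ (ℕ.s≤s (ℕ.s≤s ())) _
    no-closedWalk {n = suc (suc (suc _))} (inj₂ (inj₁ ≡.refl)) _ (ℕ.s≤s (ℕ.s≤s (ℕ.s≤s ()))) _
    no-closedWalk {n = 3} (inj₂ (inj₂ ≡.refl)) _ _ W = four-heisenberg≉0 (cubicRelation ℕP.≤-refl) x+x≈0⇒x≈0 (heisenberg≈0 ℕP.≤-refl ≡.refl)
      where open ClosedWalk W
    no-closedWalk {n = 4} (inj₂ (inj₂ ≡.refl)) _ _ W = five-heisenberg≉0 (cubicRelation ℕP.≤-refl) x+x≈0⇒x≈0 (heisenberg≈0 ℕP.≤-refl ≡.refl)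
      where open ClosedWalk W
    no-closedWalk {n = suc (suc (suc (suc (suc _))))} (inj₂ (inj₂ ≡.refl)) _ (ℕ.s≤s (ℕ.s≤s (ℕ.s≤s (ℕ.s≤s (ℕ.s≤s ()))))) _

-- Primes in intervals of bounded ratio

module PrimeGap where

  open import Data.List.Base using ([]; _∷_)
  open import Data.List.Relation.Unary.All using (All; []; _∷_)
  open import Data.Nat.Base
  open import Data.Nat.Divisibility
  open import Data.Nat.ListAction using (product)
  open import Data.Nat.Primality.Factorisation using (factorise; PrimeFactorisation)
  open import Data.Nat.Properties
  open import Data.Nat.Tactic.RingSolver using (solve-∀)
  open ≡ using (refl; sym; trans; cong; cong₂; subst; subst₂; module ≡-Reasoning)

  -- The binomial coefficient of a + b over a; this symmetric indexing avoids subtraction and makes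
  -- Pascal's rule definitional.
  binomial : ℕ → ℕ → ℕ
  binomial zero    b       = 1
  binomial (suc a) zero    = 1
  binomial (suc a) (suc b) = binomial a (suc b) + binomial (suc a) b

  binomial-zeroʳ : ∀ a → binomial a 0 ≡ 1
  binomial-zeroʳ zero    = refl
  binomial-zeroʳ (suc a) = refl

  binomial≤2^ : ∀ a b → binomial a b ≤ 2 ^ (a + b)
  binomial≤2^ zero    b       = m^n>0 2 b
  binomial≤2^ (suc a) zero    = m^n>0 2 (suc a + 0)
  binomial≤2^ (suc a) (suc b) = begin
    binomial a (suc b) + binomial (suc a) b   ≤⟨ +-mono-≤ (binomial≤2^ a (suc b)) (binomial≤2^ (suc a) b) ⟩
    2 ^ (a + suc b) + 2 ^ suc (a + b)         ≡⟨ cong (λ s → 2 ^ (a + suc b) + 2 ^ s) (+-suc a b) ⟨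
    2 ^ (a + suc b) + 2 ^ (a + suc b)         ≡⟨ cong (2 ^ (a + suc b) +_) (+-identityʳ _) ⟨
    2 ^ (suc a + suc b)                       ∎
    where open ≤-Reasoning

  binomial-monoʳ : ∀ a b → binomial a b ≤ binomial a (suc b)
  binomial-monoʳ zero    b = ≤-refl
  binomial-monoʳ (suc a) zero    = m≤n+m 1 _
  binomial-monoʳ (suc a) (suc b) = m≤n+m _ (binomial a (suc (suc b)))

  binomial-monoˡ : ∀ a b → binomial a b ≤ binomial (suc a) b
  binomial-monoˡ a zero    = ≤-reflexive (binomial-zeroʳ a)
  binomial-monoˡ a (suc b) = m≤m+n _ _

  2^≤binomial : ∀ n → 2 ^ n ≤ binomial n n
  2^≤binomial zero    = ≤-refl
  2^≤binomial (suc n) = begin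
    2 ^ n + (2 ^ n + 0)                       ≡⟨ cong (2 ^ n +_) (+-identityʳ _) ⟩
    2 ^ n + 2 ^ n                             ≤⟨ +-mono-≤ (2^≤binomial n) (2^≤binomial n) ⟩
    binomial n n + binomial n n               ≤⟨ +-mono-≤ (binomial-monoʳ n n) (binomial-monoˡ n n) ⟩
    binomial n (suc n) + binomial (suc n) n   ∎
    where open ≤-Reasoning

  binomial-! : ∀ a b → binomial a b * (a ! * b !) ≡ (a + b) !
  binomial-! zero    b       = trans (+-identityʳ _) (+-identityʳ _)
  binomial-! (suc a) zero    = trans (+-identityʳ _) (trans (*-identityʳ _) (cong _! (sym (+-identityʳ (suc a)))))
  binomial-! (suc a) (suc b) = begin
    (X + Y) * ((suc a * a !) * (suc b * b !))
      ≡⟨ expand (suc a) (suc b) X Y (a !) (b !) ⟩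
    suc a * (X * (a ! * suc b !)) + suc b * (Y * (suc a ! * b !))
      ≡⟨ cong₂ (λ s t → suc a * s + suc b * t) (binomial-! a (suc b)) (trans (binomial-! (suc a) b) (cong _! (sym (+-suc a b)))) ⟩
    suc a * (a + suc b) ! + suc b * (a + suc b) !
      ≡⟨ *-distribʳ-+ ((a + suc b) !) (suc a) (suc b) ⟨
    (suc a + suc b) ! ∎
    where
    open ≡-Reasoning
    X = binomial a (suc b)
    Y = binomial (suc a) b
    expand : ∀ a b X Y s t → (X + Y) * ((a * s) * (b * t)) ≡ a * (X * (s * (b * t))) + b * (Y * ((a * s) * t))
    expand = solve-∀

  binomial-absorbˡ : ∀ a b → suc a * binomial (suc a) b ≡ suc (a + b) * binomial a b
  binomial-absorbˡ a b = *-cancelʳ-≡ _ _ (a ! * b !) {{a !* b !≢0}} (begin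
    suc a * binomial (suc a) b * (a ! * b !)   ≡⟨ shuffle (suc a) (binomial (suc a) b) (a !) (b !) ⟩
    binomial (suc a) b * (suc a ! * b !)       ≡⟨ binomial-! (suc a) b ⟩
    suc (a + b) * (a + b) !                    ≡⟨ cong (suc (a + b) *_) (binomial-! a b) ⟨
    suc (a + b) * (binomial a b * (a ! * b !)) ≡⟨ *-assoc (suc (a + b)) (binomial a b) (a ! * b !) ⟨
    suc (a + b) * binomial a b * (a ! * b !)   ∎)
    where
    open ≡-Reasoning
    shuffle : ∀ a X s t → a * X * (s * t) ≡ X * ((a * s) * t)
    shuffle = solve-∀

  binomial-absorbʳ : ∀ a b → suc b * binomial a (suc b) ≡ suc (a + b) * binomial a b
  binomial-absorbʳ a b = *-cancelʳ-≡ _ _ (a ! * b !) {{a !* b !≢0}} (begin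
    suc b * binomial a (suc b) * (a ! * b !)   ≡⟨ shuffle (suc b) (binomial a (suc b)) (a !) (b !) ⟩
    binomial a (suc b) * (a ! * suc b !)       ≡⟨ binomial-! a (suc b) ⟩
    (a + suc b) !                              ≡⟨ cong _! (+-suc a b) ⟩
    suc (a + b) * (a + b) !                    ≡⟨ cong (suc (a + b) *_) (binomial-! a b) ⟨
    suc (a + b) * (binomial a b * (a ! * b !)) ≡⟨ *-assoc (suc (a + b)) (binomial a b) (a ! * b !) ⟨
    suc (a + b) * binomial a b * (a ! * b !)   ∎)
    where
    open ≡-Reasoning
    shuffle : ∀ a X s t → a * X * (s * t) ≡ X * (s * (a * t))
    shuffle = solve-∀

  -- The reciprocals of these numbers form the Leibniz harmonic triangle.
  leibniz : ℕ → ℕ → ℕ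
  leibniz a b = suc (a + b) * binomial a b

  binomial≢0 : ∀ a b → NonZero (binomial a b)
  binomial≢0 zero    b       = _
  binomial≢0 (suc a) zero    = _
  binomial≢0 (suc a) (suc b) = >-nonZero (≤-trans (>-nonZero⁻¹ _ {{binomial≢0 (suc a) b}}) (m≤n+m _ _))

  leibniz≢0 : ∀ a b → NonZero (leibniz a b)
  leibniz≢0 a b = m*n≢0 (suc (a + b)) (binomial a b) {{_}} {{binomial≢0 a b}}

  -- This is 1/L(a, b) = 1/L(a + 1, b) + 1/L(a, b + 1) with denominators cleared; it follows from
  -- the two absorption identities.
  leibniz-harmonic : ∀ a b →
    leibniz a b * (leibniz (suc a) b + leibniz a (suc b)) ≡ leibniz (suc a) b * leibniz a (suc b)
  leibniz-harmonic a b = begin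
    s * B * (suc (suc a + b) * X + suc (a + suc b) * Y)
      ≡⟨ cong (λ t → s * B * (suc (suc a + b) * X + suc t * Y)) (+-suc a b) ⟩
    s * B * (suc s * X + suc s * Y)
      ≡⟨ expand (s * B) (suc s) X Y ⟩
    suc s * ((s * B) * X + (s * B) * Y)
      ≡⟨ cong₂ (λ u v → suc s * (u * X + v * Y)) (binomial-absorbʳ a b) (binomial-absorbˡ a b) ⟨
    suc s * ((suc b * Y) * X + (suc a * X) * Y)
      ≡⟨ collect a b X Y ⟩
    suc (suc a + b) * X * (suc (suc (a + b)) * Y)
      ≡⟨ cong (λ t → suc (suc a + b) * X * (suc t * Y)) (+-suc a b) ⟨
    leibniz (suc a) b * leibniz a (suc b) ∎
    where
    open ≡-Reasoning
    s = suc (a + b)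
    B = binomial a b
    X = binomial (suc a) b
    Y = binomial a (suc b)
    expand : ∀ B s X Y → B * (s * X + s * Y) ≡ s * (B * X + B * Y)
    expand = solve-∀
    collect : ∀ a b X Y → suc (suc (a + b)) * ((suc b * Y) * X + (suc a * X) * Y) ≡ suc (suc a + b) * X * (suc (suc (a + b)) * Y)
    collect = solve-∀

  -- The equation says 1/t = 1/p - 1/q, hence d/t = d/p - d/q is an integer.
  ∣-harmonic : ∀ {p q t d} .{{_ : NonZero p}} .{{_ : NonZero q}} →
    p * (t + q) ≡ t * q → p ∣ d → q ∣ d → t ∣ d
  ∣-harmonic {p} {q} {t} {d} eq (divides u d≡up) (divides v d≡vq) =
    ∣m+n∣m⇒∣n (subst (t ∣_) tu≡tv+d (m∣m*n u)) (m∣m*n v)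
    where
    open ≡-Reasoning
    id₁ : ∀ t u p q → t * u * (p * q) ≡ u * p * (t * q)
    id₁ = solve-∀
    id₂ : ∀ t d p q → d * (p * (t + q)) ≡ t * p * d + d * (p * q)
    id₂ = solve-∀
    id₃ : ∀ t v d p q → t * p * (v * q) + d * (p * q) ≡ (t * v + d) * (p * q)
    id₃ = solve-∀
    tu≡tv+d : t * u ≡ t * v + d
    tu≡tv+d = *-cancelʳ-≡ _ _ (p * q) {{m*n≢0 p q}} (begin
      t * u * (p * q)               ≡⟨ id₁ t u p q ⟩
      u * p * (t * q)               ≡⟨ cong₂ _*_ d≡up eq ⟨
      d * (p * (t + q))             ≡⟨ id₂ t d p q ⟩
      t * p * d + d * (p * q)       ≡⟨ cong (λ s → t * p * s + d * (p * q)) d≡vq ⟩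
      t * p * (v * q) + d * (p * q) ≡⟨ id₃ t v d p q ⟩
      (t * v + d) * (p * q)         ∎)

  -- The border entries are the integers b + 1, and each further entry is reached by `∣-harmonic`.
  -- This bounds common multiples of 1, ..., 2n + 1 from below by a central binomial coefficient.
  leibniz-∣ : ∀ a b {d} → (∀ k → 1 ≤ k → k ≤ suc (a + b) → k ∣ d) → leibniz a b ∣ d
  leibniz-∣ zero    b {d} h = subst (_∣ d) (sym (*-identityʳ (suc b))) (h (suc b) (s≤s z≤n) ≤-refl)
  leibniz-∣ (suc a) b {d} h = ∣-harmonic {{leibniz≢0 a b}} {{leibniz≢0 a (suc b)}} (leibniz-harmonic a b)
    (leibniz-∣ a b (λ k 1≤k k≤ → h k 1≤k (m≤n⇒m≤1+n k≤)))
    (leibniz-∣ a (suc b) (λ k 1≤k k≤ → h k 1≤k (subst (k ≤_) (cong suc (+-suc a b)) k≤)))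

  -- Products of primes

  primeOrOne : ℕ → ℕ
  primeOrOne k with prime? k
  ... | yes _ = k
  ... | no  _ = 1

  -- The primes are taken from the half-open interval (m, m + d], so adjacent intervals concatenate;
  -- m = 0 gives the primorial of d.
  primeProduct : ℕ → ℕ → ℕ
  primeProduct m zero    = 1
  primeProduct m (suc d) = primeProduct m d * primeOrOne (m + suc d)

  primeOrOne≢0 : ∀ k → NonZero (primeOrOne k)
  primeOrOne≢0 k with prime? k
  ... | yes pr = prime⇒nonZero pr
  ... | no  _  = _

  primeProduct≢0 : ∀ m d → NonZero (primeProduct m d)
  primeProduct≢0 m zero    = _
  primeProduct≢0 m (suc d) = m*n≢0 _ _ {{primeProduct≢0 m d}} {{primeOrOne≢0 (m + suc d)}}

  ∣primeOrOne : ∀ {q} → Prime q → ∀ k → q ∣ primeOrOne k → q ≤ k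
  ∣primeOrOne pq k h with prime? k
  ... | yes pr = ∣⇒≤ {{prime⇒nonZero pr}} h
  ... | no  _  with refl ← ∣1⇒≡1 h = ⊥-elim (¬prime[1] pq)

  ∣primeProduct⇒≤ : ∀ {q} → Prime q → ∀ m d → q ∣ primeProduct m d → q ≤ m + d
  ∣primeProduct⇒≤ pq m zero    h with refl ← ∣1⇒≡1 h = ⊥-elim (¬prime[1] pq)
  ∣primeProduct⇒≤ pq m (suc d) h with euclidsLemma (primeProduct m d) _ pq h
  ... | inj₁ h′ = ≤-trans (∣primeProduct⇒≤ pq m d h′) (+-monoʳ-≤ m (n≤1+n d))
  ... | inj₂ h′ = ∣primeOrOne pq (m + suc d) h′

  ∣primeProduct : ∀ {q} → Prime q → ∀ m d → m < q → q ≤ m + d → q ∣ primeProduct m d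
  ∣primeProduct {q} pq m zero    m<q q≤ = ⊥-elim (<⇒≱ m<q (subst (q ≤_) (+-identityʳ m) q≤))
  ∣primeProduct {q} pq m (suc d) m<q q≤ with q ≟ m + suc d
  ... | no  q≢ = ∣m⇒∣m*n _ (∣primeProduct pq m d m<q (s≤s⁻¹ (subst (q <_) (+-suc m d) (≤∧≢⇒< q≤ q≢))))
  ... | yes refl with prime? (m + suc d)
  ...   | yes _  = n∣m*n (primeProduct m d)
  ...   | no  ¬p = ⊥-elim (¬p pq)

  -- Write x = t P with P the product so far: the next prime divides t, because all prime factors of
  -- P are smaller.
  primeProduct-∣ : ∀ m d {x} → (∀ q → Prime q → m < q → q ≤ m + d → q ∣ x) → primeProduct m d ∣ x
  primeProduct-∣ m zero    h = 1∣ _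
  primeProduct-∣ m (suc d) {x} h with prime? (m + suc d)
  ... | no  _  = subst (_∣ x) (sym (*-identityʳ _)) ih
    where
    ih = primeProduct-∣ m d (λ q pq m<q q≤ → h q pq m<q (≤-trans q≤ (+-monoʳ-≤ m (n≤1+n d))))
  ... | yes pr with primeProduct-∣ m d {x} (λ q pq m<q q≤ → h q pq m<q (≤-trans q≤ (+-monoʳ-≤ m (n≤1+n d))))
  ...   | divides t x≡t*P with euclidsLemma t (primeProduct m d) pr (subst (_ ∣_) x≡t*P (h _ pr (m<m+n m (s≤s z≤n)) ≤-refl))
  ...     | inj₁ q∣t = subst₂ _∣_ (*-comm (m + suc d) (primeProduct m d)) (sym x≡t*P) (*-monoˡ-∣ (primeProduct m d) q∣t)
  ...     | inj₂ q∣P = ⊥-elim (<⇒≱ (+-monoʳ-< m (n<1+n d)) (∣primeProduct⇒≤ pr m d q∣P))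

  primeProduct-+ : ∀ m d e → primeProduct m (d + e) ≡ primeProduct m d * primeProduct (m + d) e
  primeProduct-+ m d zero    = trans (cong (primeProduct m) (+-identityʳ d)) (sym (*-identityʳ _))
  primeProduct-+ m d (suc e) = begin
    primeProduct m (d + suc e)
      ≡⟨ cong (primeProduct m) (+-suc d e) ⟩
    primeProduct m (d + e) * primeOrOne (m + suc (d + e))
      ≡⟨ cong₂ (λ s t → s * primeOrOne t) (primeProduct-+ m d e)
           (trans (cong (m +_) (sym (+-suc d e))) (sym (+-assoc m d (suc e)))) ⟩
    primeProduct m d * primeProduct (m + d) e * primeOrOne (m + d + suc e)
      ≡⟨ *-assoc (primeProduct m d) _ _ ⟩
    primeProduct m d * primeProduct (m + d) (suc e) ∎
    where open ≡-Reasoning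

  prime∣!⇒≤ : ∀ {q} → Prime q → ∀ n → q ∣ n ! → q ≤ n
  prime∣!⇒≤ pq zero    h with refl ← ∣1⇒≡1 h = ⊥-elim (¬prime[1] pq)
  prime∣!⇒≤ pq (suc n) h with euclidsLemma (suc n) (n !) pq h
  ... | inj₁ h′ = ∣⇒≤ h′
  ... | inj₂ h′ = m≤n⇒m≤1+n (prime∣!⇒≤ pq n h′)

  ∣! : ∀ {q n} .{{_ : NonZero q}} → q ≤ n → q ∣ n !
  ∣! {suc q} q≤n = ∣-trans (m∣m*n (q !)) (m≤n⇒m!∣n! q≤n)

  -- A prime in (k, 2k] divides (2k)! but not k!, hence it divides the central binomial coefficient.
  primeProduct-doubling : ∀ k → primeProduct k k ≤ 2 ^ (k + k)
  primeProduct-doubling k = ≤-trans (∣⇒≤ {{binomial≢0 k k}} (primeProduct-∣ k k divide)) (binomial≤2^ k k)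
    where
    divide : ∀ q → Prime q → k < q → q ≤ k + k → q ∣ binomial k k
    divide q pq k<q q≤2k with euclidsLemma (binomial k k) (k ! * k !) pq
                               (subst (q ∣_) (sym (binomial-! k k)) (∣! {{prime⇒nonZero pq}} q≤2k))
    ... | inj₁ h = h
    ... | inj₂ h with euclidsLemma (k !) (k !) pq h
    ...   | inj₁ h′ = ⊥-elim (<⇒≱ k<q (prime∣!⇒≤ pq k h′))
    ...   | inj₂ h′ = ⊥-elim (<⇒≱ k<q (prime∣!⇒≤ pq k h′))

  primorial-bound : ∀ j → primeProduct 0 (2 ^ j) ≤ 2 ^ (2 ^ j + 2 ^ j)
  primorial-bound zero    = s≤s z≤n
  primorial-bound (suc j) = begin
    primeProduct 0 (2 ^ suc j)                  ≡⟨ cong (primeProduct 0) 2^suc ⟩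
    primeProduct 0 (k + k)                      ≡⟨ primeProduct-+ 0 k k ⟩
    primeProduct 0 k * primeProduct k k         ≤⟨ *-mono-≤ (primorial-bound j) (primeProduct-doubling k) ⟩
    2 ^ (k + k) * 2 ^ (k + k)                   ≡⟨ ^-distribˡ-+-* 2 (k + k) (k + k) ⟨
    2 ^ ((k + k) + (k + k))                     ≡⟨ cong (λ s → 2 ^ (s + s)) 2^suc ⟨
    2 ^ (2 ^ suc j + 2 ^ suc j)                 ∎
    where
    open ≤-Reasoning
    k = 2 ^ j
    2^suc : 2 ^ suc j ≡ k + k
    2^suc = cong (k +_) (+-identityʳ k)

  -- Divisibility tested on prime powers

  prime-∤-prime : ∀ {p q} → Prime p → Prime q → p ≢ q → p ∤ q
  prime-∤-prime pp pq p≢q h with prime⇒irreducible pq h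
  ... | inj₁ refl = ¬prime[1] pp
  ... | inj₂ p≡q  = p≢q p≡q

  primePower-∣ : ∀ {p q x} → Prime p → Prime q → q ≢ p → ∀ a → q ^ a ∣ p * x → q ^ a ∣ x
  primePower-∣ pp pq q≢p zero h = 1∣ _
  primePower-∣ {p} {q} {x} pp pq q≢p (suc a) h with euclidsLemma p x pq (m*n∣⇒m∣ q (q ^ a) h)
  ... | inj₁ q∣p = ⊥-elim (prime-∤-prime pq pp q≢p q∣p)
  ... | inj₂ (divides x′ refl) = subst (q ^ suc a ∣_) (*-comm q x′)
    (*-monoʳ-∣ q (primePower-∣ pp pq q≢p a (*-cancelˡ-∣ q {{prime⇒nonZero pq}} (subst (q ^ suc a ∣_) (shuffle p x′ q) h))))
    where
    shuffle : ∀ p x q → p * (x * q) ≡ q * (p * x)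
    shuffle = solve-∀

  -- The first prime p is cancelled from both sides: the test for powers of p moves by one exponent,
  -- and for other primes it is unchanged.
  product-∣ : ∀ ps → All Prime ps → ∀ d → (∀ q a → Prime q → q ^ a ∣ product ps → q ^ a ∣ d) → product ps ∣ d
  product-∣ []       []         d h = 1∣ d
  product-∣ (p ∷ ps) (pp ∷ pps) d h with h p 1 pp (subst (_∣ product (p ∷ ps)) (sym (*-identityʳ p)) (m∣m*n (product ps)))
  ... | p¹∣d with subst (_∣ d) (*-identityʳ p) p¹∣d
  ...   | divides d′ refl = subst (product (p ∷ ps) ∣_) (*-comm p d′) (*-monoʳ-∣ p (product-∣ ps pps d′ step))
    where
    step : ∀ q a → Prime q → q ^ a ∣ product ps → q ^ a ∣ d′
    step q a pq hq with q ≟ p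
    ... | yes refl = *-cancelˡ-∣ p {{prime⇒nonZero pp}} (subst (q ^ suc a ∣_) (*-comm d′ p) (h q (suc a) pq (*-monoʳ-∣ p hq)))
    ... | no  q≢p  = primePower-∣ pp pq q≢p a (subst (q ^ a ∣_) (*-comm d′ p) (h q a pq (∣n⇒∣m*n p hq)))

  ∣-primePowers : ∀ k .{{_ : NonZero k}} d → (∀ q a → Prime q → q ^ a ∣ k → q ^ a ∣ d) → k ∣ d
  ∣-primePowers k d h = subst (_∣ d) (sym eq) (product-∣ factors factorsPrime d (λ q a pq h′ → h q a pq (subst (q ^ a ∣_) (sym eq) h′)))
    where
    open PrimeFactorisation (factorise k) renaming (isFactorisation to eq)

  -- The contradiction from a long gap

  !≤^ : ∀ n s → n ≤ s → n ! ≤ s ^ n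
  !≤^ zero    s n≤s = ≤-refl
  !≤^ (suc n) s n≤s = *-mono-≤ n≤s (!≤^ n s (≤-trans (n≤1+n n) n≤s))

  ^-cancelʳ-≤ : ∀ m → 1 < m → ∀ {x y} → m ^ x ≤ m ^ y → x ≤ y
  ^-cancelʳ-≤ m 1<m h = ≮⇒≥ (λ y<x → <⇒≱ (^-monoʳ-< m 1<m y<x) h)

  ∣^ : ∀ {x y} → x ∣ y → ∀ a {b} → a ≤ b → x ^ a ∣ y ^ b
  ∣^ h zero    _         = 1∣ _
  ∣^ h (suc a) (s≤s a≤b) = *-pres-∣ h (∣^ h a a≤b)

  -- The origin of the ratio 4^11: the inequality fails at u = 10 and persists from u = 11 on.
  16u²≤2^u : ∀ t → 16 * ((t + 11) * (t + 11)) ≤ 2 ^ (t + 11)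
  16u²≤2^u zero    = ≤ᵇ⇒≤ 1936 2048 _
  16u²≤2^u (suc t) = begin
    16 * ((suc t + 11) * (suc t + 11))                                     ≤⟨ m≤m+n _ _ ⟩
    16 * ((suc t + 11) * (suc t + 11)) + 16 * (t * t + 20 * t + 98)        ≡⟨ double t ⟩
    2 * (16 * ((t + 11) * (t + 11)))                                       ≤⟨ *-monoʳ-≤ 2 (16u²≤2^u t) ⟩
    2 ^ (suc t + 11)                                                       ∎
    where
    open ≤-Reasoning
    double : ∀ t → 16 * ((suc t + 11) * (suc t + 11)) + 16 * (t * t + 20 * t + 98) ≡ 2 * (16 * ((t + 11) * (t + 11)))
    double = solve-∀

  module _ (t : ℕ) where

    private
      -- The interval is (M, 2^E], and `s` is the square root of its upper end. The upper end equals
      -- 4n, which leaves room for 2n + 1.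
      u = t + 11
      E = u + u
      M = 2 ^ (t + t)
      s = 2 ^ u
      n = 2 ^ (t + t + 20)
      D = (s !) ^ E * primeProduct 0 M

    -- If no prime lies in (M, 2^E], every k ≤ 2^E divides D: a prime power q^a dividing k has a ≤ E, and a ≤ 1 unless q ≤ s.
    all-∣ : (∀ q → Prime q → M < q → ¬ q ≤ 2 ^ E) → ∀ k → 1 ≤ k → k ≤ 2 ^ E → k ∣ D
    all-∣ gap k 1≤k k≤N = ∣-primePowers k {{k≢0}} D primePower
      where
      k≢0 : NonZero k
      k≢0 = >-nonZero 1≤k
      primePower : ∀ q a → Prime q → q ^ a ∣ k → q ^ a ∣ D
      primePower q a pq h with q ≤? s
      ... | yes q≤s = ∣m⇒∣m*n _ (∣^ (∣! {{prime⇒nonZero pq}} q≤s) a a≤E)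
        where
        open ≤-Reasoning
        a≤E : a ≤ E
        a≤E = ^-cancelʳ-≤ 2 ≤-refl (begin
          2 ^ a ≤⟨ ^-monoˡ-≤ a (nonTrivial⇒n>1 q {{prime⇒nonTrivial pq}}) ⟩
          q ^ a ≤⟨ ∣⇒≤ {{k≢0}} h ⟩
          k     ≤⟨ k≤N ⟩
          2 ^ E ∎)
      primePower q zero          pq h | no q≰s = 1∣ _
      primePower q 1             pq h | no q≰s =
        ∣n⇒∣m*n ((s !) ^ E) (subst (_∣ primeProduct 0 M) (sym (*-identityʳ q))
          (∣primeProduct pq 0 M (>-nonZero⁻¹ q {{prime⇒nonZero pq}})
          (≮⇒≥ (λ M<q → gap q pq M<q (≤-trans (∣⇒≤ {{k≢0}} (subst (_∣ k) (*-identityʳ q) h)) k≤N)))))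
      primePower q (suc (suc a)) pq h | no q≰s = ⊥-elim (<⇒≱ 2^E<q^2
        (≤-trans (∣⇒≤ {{k≢0}} (m*n∣⇒m∣ (q * q) (q ^ a) (subst (_∣ k) (sym (*-assoc q q (q ^ a))) h))) k≤N))
        where
        open ≤-Reasoning
        2^E<q^2 : 2 ^ E < q * q
        2^E<q^2 = begin-strict
          2 ^ E  ≡⟨ ^-distribˡ-+-* 2 u u ⟩
          s * s  <⟨ *-mono-< (≰⇒> q≰s) (≰⇒> q≰s) ⟩
          q * q  ∎

    D-bound : D ≤ 2 ^ (u * s * E + (M + M))
    D-bound = begin
      (s !) ^ E * primeProduct 0 M  ≤⟨ *-mono-≤ (^-monoˡ-≤ E (!≤^ s s ≤-refl)) (primorial-bound (t + t)) ⟩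
      (s ^ s) ^ E * 2 ^ (M + M)     ≡⟨ cong (λ x → x ^ E * 2 ^ (M + M)) (^-*-assoc 2 u s) ⟩
      (2 ^ (u * s)) ^ E * 2 ^ (M + M) ≡⟨ cong (_* 2 ^ (M + M)) (^-*-assoc 2 (u * s) E) ⟩
      2 ^ (u * s * E) * 2 ^ (M + M) ≡⟨ ^-distribˡ-+-* 2 (u * s * E) (M + M) ⟨
      2 ^ (u * s * E + (M + M))     ∎
      where open ≤-Reasoning

    -- With W = n/4, the first summand is 2u²s ≤ 2W, because 16u² ≤ s and s² = 16W; the second is at
    -- most W.
    exponent-bound : u * s * E + (M + M) < n
    exponent-bound = begin-strict
      u * s * E + (M + M)       ≡⟨ cong (_+ (M + M)) (rearrange u s) ⟩
      2 * (u * u * s) + (M + M) ≤⟨ +-mono-≤ (*-monoʳ-≤ 2 u²s≤W) (≤-reflexive (cong (M +_) (sym (+-identityʳ M)))) ⟩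
      2 * W + 2 * M             ≤⟨ +-monoʳ-≤ (2 * W) 2M≤W ⟩
      2 * W + W                 <⟨ m<m+n (2 * W + W) (m^n>0 2 (t + t + 18)) ⟩
      2 * W + W + W             ≡⟨ four W ⟩
      2 * (2 * W)               ≡⟨ cong (2 ^_) (+-comm 2 (t + t + 18)) ⟩
      2 ^ (t + t + 18 + 2)      ≡⟨ cong (2 ^_) (+-assoc (t + t) 18 2) ⟩
      n                         ∎
      where
      open ≤-Reasoning
      W = 2 ^ (t + t + 18)
      rearrange : ∀ u s → u * s * (u + u) ≡ 2 * (u * u * s)
      rearrange = solve-∀
      four : ∀ w → 2 * w + w + w ≡ 2 * (2 * w)
      four = solve-∀
      2M≤W : 2 * M ≤ W
      2M≤W = ^-monoʳ-≤ 2 (≤-trans (≤-reflexive (+-comm 1 (t + t))) (+-monoʳ-≤ (t + t) (s≤s z≤n)))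
      double-exponent : ∀ t → (t + 11) + (t + 11) ≡ (t + t + 18) + 4
      double-exponent = solve-∀
      shuffle : ∀ x s → x * s * 16 ≡ 16 * x * s
      shuffle = solve-∀
      u²s≤W : u * u * s ≤ W
      u²s≤W = *-cancelʳ-≤ _ _ 16 (begin
        u * u * s * 16    ≡⟨ shuffle (u * u) s ⟩
        16 * (u * u) * s  ≤⟨ *-monoˡ-≤ s (16u²≤2^u t) ⟩
        s * s             ≡⟨ ^-distribˡ-+-* 2 u u ⟨
        2 ^ (u + u)       ≡⟨ cong (2 ^_) (double-exponent t) ⟩
        2 ^ (t + t + 18 + 4) ≡⟨ ^-distribˡ-+-* 2 (t + t + 18) 4 ⟩
        W * 16            ∎)

    2n+1≤N : suc (n + n) ≤ 2 ^ E
    2n+1≤N = begin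
      suc (n + n)              ≤⟨ s≤s (≤-reflexive (cong (n +_) (sym (+-identityʳ n)))) ⟩
      suc (2 ^ (1 + (t + t + 20)))   ≤⟨ ^-monoʳ-< 2 ≤-refl (n<1+n (1 + (t + t + 20))) ⟩
      2 ^ (2 + (t + t + 20))         ≡⟨ cong (2 ^_) (exponent t) ⟩
      2 ^ E                    ∎
      where
      open ≤-Reasoning
      exponent : ∀ t → 2 + (t + t + 20) ≡ (t + 11) + (t + 11)
      exponent = solve-∀

    no-gap : ¬ (∀ q → Prime q → M < q → ¬ q ≤ 2 ^ E)
    no-gap gap = <⇒≱ (^-monoʳ-< 2 ≤-refl exponent-bound) (begin
      2 ^ n                       ≤⟨ 2^≤binomial n ⟩
      binomial n n                ≤⟨ ∣⇒≤ {{m*n≢0 _ _ {{m^n≢0 (s !) E {{s !≢0}}}} {{primeProduct≢0 0 M}}}}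
                                      (m*n∣⇒n∣ (suc (n + n)) (binomial n n)
                                        (leibniz-∣ n n (λ k 1≤k k≤ → all-∣ gap k 1≤k (≤-trans k≤ 2n+1≤N)))) ⟩
      D                           ≤⟨ D-bound ⟩
      2 ^ (u * s * E + (M + M))   ∎)
      where open ≤-Reasoning

    prime-between : ∃ λ q → Prime q × 2 ^ (t + t) < q × q ≤ 2 ^ (t + 11 + (t + 11))
    -- `no-gap` only refutes the absence of a prime; the decidable bounded search turns this into a
    -- witness.
    prime-between with anyUpTo? (λ q → prime? q ×-dec (M <? q)) (suc (2 ^ E))
    ... | yes (q , s≤s q≤N , pq , M<q) = q , pq , M<q , q≤N
    ... | no  ¬any = ⊥-elim (no-gap (λ q pq M<q q≤N → ¬any (q , s≤s q≤N , pq , M<q)))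

-- The incidence graph

module Congruence (p : ℕ) where

  open import Data.Integer.Base using (+_; _+_; _*_; _-_; -_; 1ℤ; ∣_∣)
  open import Data.Integer.DivMod using (_%ℕ_; _/ℕ_; n%ℕd<d; a≡a%ℕn+[a/ℕn]*n)
  open import Data.Integer.Divisibility.Signed using (_∣_; divides; ∣ᵤ⇒∣; ∣⇒∣ᵤ; ∣m∣n⇒∣m+n; ∣m⇒∣-m; ∣n⇒∣m*n; ∣m⇒∣m*n)
  open import Data.Integer.Tactic.RingSolver using (solve-∀)

  infix 4 _≈_

  -- Wrapping the divisibility in a record lets unification recover `x` and `y`.
  record _≈_ (x y : ℤ) : Set where
    constructor mod
    field difference : + p ∣ x - y
  open _≈_ public

  reflexive : ∀ {x y} → x ≡ y → x ≈ y
  reflexive {x} ≡.refl = mod (divides 0ℤ (ℤP.+-inverseʳ x))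

  sym : ∀ {x y} → x ≈ y → y ≈ x
  sym {x} {y} (mod d) = mod (≡.subst (+ p ∣_) (id x y) (∣m⇒∣-m d))
    where
    id : ∀ x y → - (x - y) ≡ y - x
    id = solve-∀

  trans : ∀ {x y z} → x ≈ y → y ≈ z → x ≈ z
  trans {x} {y} {z} (mod d) (mod e) = mod (≡.subst (+ p ∣_) (id x y z) (∣m∣n⇒∣m+n d e))
    where
    id : ∀ x y z → (x - y) + (y - z) ≡ x - z
    id = solve-∀

  +-cong : ∀ {x y u v} → x ≈ y → u ≈ v → x + u ≈ y + v
  +-cong {x} {y} {u} {v} (mod d) (mod e) = mod (≡.subst (+ p ∣_) (id x y u v) (∣m∣n⇒∣m+n d e))
    where
    id : ∀ x y u v → (x - y) + (u - v) ≡ (x + u) - (y + v)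
    id = solve-∀

  -‿cong : ∀ {x y} → x ≈ y → - x ≈ - y
  -‿cong {x} {y} (mod d) = mod (≡.subst (+ p ∣_) (id x y) (∣m⇒∣-m d))
    where
    id : ∀ x y → - (x - y) ≡ - x - - y
    id = solve-∀

  *-cong : ∀ {x y u v} → x ≈ y → u ≈ v → x * u ≈ y * v
  *-cong {x} {y} {u} {v} (mod d) (mod e) =
    mod (≡.subst (+ p ∣_) (id x y u v) (∣m∣n⇒∣m+n (∣m⇒∣m*n u d) (∣n⇒∣m*n y e)))
    where
    id : ∀ x y u v → (x - y) * u + y * (u - v) ≡ x * u - y * v
    id = solve-∀

  ring : CommutativeRing 0ℓ 0ℓ
  ring = record
    { Carrier = ℤ ; _≈_ = _≈_ ; _+_ = _+_ ; _*_ = _*_ ; -_ = -_ ; 0# = 0ℤ ; 1# = 1ℤ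
    ; isCommutativeRing = record
      { isRing = record
        { +-isAbelianGroup = record
          { isGroup = record
            { isMonoid = record
              { isSemigroup = record
                { isMagma = record
                  { isEquivalence = record { refl = reflexive ≡.refl ; sym = sym ; trans = trans }
                  ; ∙-cong = +-cong }
                ; assoc = λ x y z → reflexive (ℤP.+-assoc x y z) }
              ; identity = reflexive ∘ ℤP.+-identityˡ , reflexive ∘ ℤP.+-identityʳ }
            ; inverse = reflexive ∘ ℤP.+-inverseˡ , reflexive ∘ ℤP.+-inverseʳ
            ; ⁻¹-cong = -‿cong }
          ; comm = λ x y → reflexive (ℤP.+-comm x y) }
        ; *-cong = *-cong
        ; *-assoc = λ x y z → reflexive (ℤP.*-assoc x y z)
        ; *-identity = reflexive ∘ ℤP.*-identityˡ , reflexive ∘ ℤP.*-identityʳ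
        ; distrib = (λ x y z → reflexive (ℤP.*-distribˡ-+ x y z)) , (λ x y z → reflexive (ℤP.*-distribʳ-+ x y z)) }
      ; *-comm = λ x y → reflexive (ℤP.*-comm x y) } }

  reduction : AlmostCommutativeRing.rawRing (fromCommutativeRing ℤP.+-*-commutativeRing)
              -Raw-AlmostCommutative⟶ fromCommutativeRing ring
  reduction = record
    { ⟦_⟧ = λ x → x
    ; +-homo = λ _ _ → reflexive ≡.refl ; *-homo = λ _ _ → reflexive ≡.refl ; -‿homo = λ _ → reflexive ≡.refl
    ; 0-homo = reflexive ≡.refl ; 1-homo = reflexive ≡.refl }

  ≈0⇒∣ : ∀ {x} → x ≈ 0ℤ → p ℕD.∣ ∣ x ∣
  ≈0⇒∣ {x} (mod d) = ∣⇒∣ᵤ (≡.subst (+ p ∣_) (ℤP.+-identityʳ x) d)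

  ∣⇒≈0 : ∀ {x} → p ℕD.∣ ∣ x ∣ → x ≈ 0ℤ
  ∣⇒≈0 {x} h = mod (≡.subst (+ p ∣_) (≡.sym (ℤP.+-identityʳ x)) (∣ᵤ⇒∣ h))

  integral : Prime p → ∀ {x y} → x * y ≈ 0ℤ → x ≈ 0ℤ ⊎ y ≈ 0ℤ
  integral pr {x} {y} h with euclidsLemma ∣ x ∣ ∣ y ∣ pr (≡.subst (p ℕD.∣_) (ℤP.abs-* x y) (≈0⇒∣ h))
  ... | inj₁ k = inj₁ (∣⇒≈0 k)
  ... | inj₂ k = inj₂ (∣⇒≈0 k)

  odd : Prime p → 2 ℕ.< p → ∀ {x} → x + x ≈ 0ℤ → x ≈ 0ℤ
  odd pr 2<p {x} h with integral pr {+ 2} {x} (≡.subst (_≈ 0ℤ) (id x) h)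
    where
    id : ∀ x → x + x ≡ + 2 * x
    id = solve-∀
  ... | inj₁ k = ⊥-elim (ℕP.<⇒≱ 2<p (ℕD.∣⇒≤ (≈0⇒∣ {+ 2} k)))
  ... | inj₂ k = k

  value : Fin p → ℤ
  value i = + toℕ i

  value-injective : ∀ {i j} → value i ≈ value j → i ≡ j
  value-injective {i} {j} (mod d) =
    toℕ-injective (ℤP.+-injective (ℤP.i-j≡0⇒i≡j (value i) (value j) (ℤP.∣i∣≡0⇒i≡0 (small ∣ value i - value j ∣ bound (∣⇒∣ᵤ d)))))
    where
    bound : ∣ value i - value j ∣ ℕ.< p
    bound = ≡.subst (ℕ._< p) (≡.cong ∣_∣ (≡.sym (ℤP.m-n≡m⊖n (toℕ i) (toℕ j))))
      (ℕP.≤-<-trans (ℤP.∣m⊝n∣≤m⊔n (toℕ i) (toℕ j)) (ℕP.⊔-pres-<m (toℕ<n i) (toℕ<n j)))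
    small : ∀ x → x ℕ.< p → p ℕD.∣ x → x ≡ 0
    small zero    _   _ = ≡.refl
    small (suc x) x<p h = ⊥-elim (ℕP.<⇒≱ x<p (ℕD.∣⇒≤ h))

  residue : .{{_ : ℕ.NonZero p}} → ℤ → Fin p
  residue x = fromℕ< (n%ℕd<d x p)

  value-residue : .{{_ : ℕ.NonZero p}} → ∀ x → value (residue x) ≈ x
  value-residue x = sym (mod (divides (x /ℕ p) (≡.trans
    (≡.cong₂ (λ u v → u - + v) (a≡a%ℕn+[a/ℕn]*n x p) (toℕ-fromℕ< (n%ℕd<d x p)))
    (id (+ (x %ℕ p)) (x /ℕ p * + p)))))
    where
    id : ∀ r s → (r + s) - r ≡ s
    id = solve-∀

funToFin-cong : ∀ {m n} {f g : Fin m → Fin n} → (∀ i → f i ≡ g i) → funToFin f ≡ funToFin g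
funToFin-cong {zero}  h = ≡.refl
funToFin-cong {suc m} h = ≡.cong₂ combine (h zero) (funToFin-cong (h ∘ suc))

finToFun-injective : ∀ {m n} {i j : Fin (n ℕ.^ m)} → (∀ k → finToFun {n} {m} i k ≡ finToFun j k) → i ≡ j
finToFun-injective {m} {n} {i} {j} h =
  ≡.trans (≡.sym (funToFin-finToFin {m} {n} i)) (≡.trans (funToFin-cong h) (funToFin-finToFin {m} {n} j))

-- The walk v₀, w₀, v₁, w₁, ... has length 2q and is encoded by q-periodic sequences. Only
-- consecutive vertices of a side must differ, so excluding such walks also excludes cycles.
record ClosedNonBacktrackingWalk {V : Set} (_∼_ : V → V → Set) (q : ℕ) : Set where
  field
    v w        : ℕ → V
    v∼w        : ∀ j → v j ∼ w j
    sv∼w       : ∀ j → v (suc j) ∼ w j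
    v-distinct : ∀ j → v j ≢ v (suc j)
    w-distinct : ∀ j → w j ≢ w (suc j)
    v-periodic : ∀ j → v (j ℕ.+ q) ≡ v j
    w-periodic : ∀ j → w (j ℕ.+ q) ≡ w j

-- A bipartite graph of girth greater than 2ℓ with both sides Fin (p ^ ℓ); edges are listed from one side.
record BipartiteGraph (p ℓ : ℕ) : Set where
  V : Set
  V = Fin (p ℕ.^ ℓ)
  field
    neighbour : V → Fin p → V
    neighbour-injective : ∀ v {i j} → neighbour v i ≡ neighbour v j → i ≡ j

  _∼_ : V → V → Set
  v ∼ w = ∃ λ i → neighbour v i ≡ w

  field
    no-closed-walk : ∀ {q} → 2 ℕ.≤ q → q ℕ.≤ ℓ → ¬ ClosedNonBacktrackingWalk _∼_ q

ℓ>0 : ∀ {ℓ} → ℓ ≡ 2 ⊎ ℓ ≡ 3 ⊎ ℓ ≡ 5 → 0 ℕ.< ℓ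
ℓ>0 (inj₁ ≡.refl)        = ℕ.s≤s ℕ.z≤n
ℓ>0 (inj₂ (inj₁ ≡.refl)) = ℕ.s≤s ℕ.z≤n
ℓ>0 (inj₂ (inj₂ ≡.refl)) = ℕ.s≤s ℕ.z≤n

module Hexagon {p} (pr : Prime p) (2<p : 2 ℕ.< p) {ℓ} (ℓ∈ : ℓ ≡ 2 ⊎ ℓ ≡ 3 ⊎ ℓ ≡ 5) where

  open Congruence p
  open IntegralDomain ring reduction (integral pr) using (point; point-determines; ClosedWalk; no-closedWalk)

  private
    instance
      p≢0 : ℕ.NonZero p
      p≢0 = prime⇒nonZero pr

    ℓ≤5 : ∀ {ℓ} → ℓ ≡ 2 ⊎ ℓ ≡ 3 ⊎ ℓ ≡ 5 → ℓ ℕ.≤ 5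
    ℓ≤5 (inj₁ ≡.refl)        = ℕ.s≤s (ℕ.s≤s ℕ.z≤n)
    ℓ≤5 (inj₂ (inj₁ ≡.refl)) = ℕ.s≤s (ℕ.s≤s (ℕ.s≤s ℕ.z≤n))
    ℓ≤5 (inj₂ (inj₂ ≡.refl)) = ℕP.≤-refl

    0<ℓ : 0 ℕ.< ℓ
    0<ℓ = ℓ>0 ℓ∈

    -- Extension by zero lets the formulas of `point`, written for five coordinates, apply to each
    -- ℓ.
    pad : ∀ {m} → (Fin m → Fin p) → ℕ → ℤ
    pad {zero}  f k       = 0ℤ
    pad {suc m} f zero    = value (f zero)
    pad {suc m} f (suc k) = pad (f ∘ suc) k

    pad-toℕ : ∀ {m} (f : Fin m → Fin p) i → pad f (toℕ i) ≡ value (f i)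
    pad-toℕ f zero    = ≡.refl
    pad-toℕ f (suc i) = pad-toℕ (f ∘ suc) i

    V = Fin (p ℕ.^ ℓ)

    coordinate : V → Fin ℓ → Fin p
    coordinate = finToFun {p} {ℓ}

    line : V → ℕ → ℤ
    line v = pad (coordinate v)

    neighbour : V → Fin p → V
    neighbour v a = funToFin {ℓ} {p} (λ i → residue (point (toℕ i) (line v) (value a)))

    coordinate-neighbour : ∀ v a k (k<ℓ : k ℕ.< ℓ) →
      value (coordinate (neighbour v a) (fromℕ< k<ℓ)) ≈ point k (line v) (value a)
    coordinate-neighbour v a k k<ℓ = trans
      (reflexive (≡.cong value (finToFun-funToFin (λ i → residue (point (toℕ i) (line v) (value a))) (fromℕ< k<ℓ))))
      (trans (value-residue _) (reflexive (≡.cong (λ k → point k (line v) (value a)) (toℕ-fromℕ< k<ℓ))))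

    -- Coordinate 0 of a neighbour is the parameter itself, so a point reveals which parameter
    -- produced it.
    abscissa : V → Fin p
    abscissa w = coordinate w (fromℕ< 0<ℓ)

    abscissa-neighbour : ∀ v a → abscissa (neighbour v a) ≡ a
    abscissa-neighbour v a = value-injective (coordinate-neighbour v a 0 0<ℓ)

    _∼_ : V → V → Set
    v ∼ w = ∃ λ i → neighbour v i ≡ w

    incident-abscissa : ∀ v {w} → v ∼ w → neighbour v (abscissa w) ≡ w
    incident-abscissa v (i , ≡.refl) = ≡.cong (neighbour v) (abscissa-neighbour v i)

    incident-point : ∀ {v v′ w} → v ∼ w → v′ ∼ w → ∀ k → k ℕ.< ℓ →
      point k (line v) (value (abscissa w)) ≈ point k (line v′) (value (abscissa w))
    incident-point {v} {v′} {w} h h′ k k<ℓ = trans (sym (coordinate-neighbour v (abscissa w) k k<ℓ))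
      (trans (reflexive (≡.cong (λ x → value (coordinate x (fromℕ< k<ℓ))) (≡.trans (incident-abscissa v h) (≡.sym (incident-abscissa v′ h′)))))
        (coordinate-neighbour v′ (abscissa w) k k<ℓ))

    line-distinct : ∀ {v v′ w} → v ∼ w → v′ ∼ w → v ≢ v′ → ¬ line v′ 0 ≈ line v 0
    line-distinct {v} {v′} h h′ v≢v′ d = v≢v′ (finToFun-injective {ℓ} {p} (λ i → value-injective
      (trans (reflexive (≡.sym (pad-toℕ (coordinate v) i)))
      (trans (sym (point-determines {y = line v} {line v′} (ℓ≤5 ℓ∈) (incident-point h h′) d (toℕ i) (toℕ<n i)))
        (reflexive (pad-toℕ (coordinate v′) i))))))

  bipartiteGraph : BipartiteGraph p ℓ
  bipartiteGraph = record
    { neighbour = neighbour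
    ; neighbour-injective = λ v {i} {j} eq →
        ≡.trans (≡.sym (abscissa-neighbour v i)) (≡.trans (≡.cong abscissa eq) (abscissa-neighbour v j))
    ; no-closed-walk = λ { {suc n} (ℕ.s≤s 1≤n) n<ℓ W →
        let open ClosedNonBacktrackingWalk W in
        no-closedWalk (odd pr 2<p) ℓ∈ 1≤n n<ℓ (record
          { y = λ j → line (v j)
          ; a = λ j → value (abscissa (w j))
          ; incident = λ j → incident-point (v∼w j) (sv∼w j)
          ; y-distinct = λ j → line-distinct (v∼w j) (sv∼w j) (v-distinct j)
          -- Both `w j` and `w (suc j)` lie on the line `v (suc j)`, where a point is determined by
          -- its parameter.
          ; a-distinct = λ j d → w-distinct j (≡.trans (≡.sym (incident-abscissa (v (suc j)) (sv∼w j)))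
              (≡.trans (≡.cong (neighbour (v (suc j))) (value-injective d)) (incident-abscissa (v (suc j)) (v∼w (suc j)))))
          ; y-periodic = λ j k → ≡.cong (λ x → line x k) (v-periodic j)
          ; a-periodic = λ j → ≡.cong (λ x → value (abscissa x)) (w-periodic j) }) }
    }

-- The hypergraph

module Hypergraph where

  open import Data.Fin.Properties using (suc-injective)
  open import Data.Fin.Subset using (Subset; inside; outside; ⁅_⁆; _∪_; ∣_∣) renaming (⊥ to ∅; _∈_ to _∈ˢ_; _∉_ to _∉ˢ_)
  open import Data.Fin.Subset.Properties using (x∈⁅x⁆; x∈⁅y⁆⇒x≡y; x∈p∪q⁺; x∈p∪q⁻; ∉⊥; ∪-identityˡ; ∣⊥∣≡0)
  open import Data.List.Base using (tabulate)
  open import Data.List.Membership.Propositional using (_∈_)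
  open import Data.List.Membership.Propositional.Properties using (∈-tabulate⁻)
  open import Data.List.Properties using (length-tabulate)
  import Data.List.Relation.Unary.All.Properties as All
  import Data.List.Relation.Unary.Unique.Propositional.Properties as Unique
  open import Data.Nat.Base using (_+_; _*_; _∸_; _^_; _≤_; _<_; z≤n; s≤s)
  open import Data.Nat.DivMod using (_%_; _/_; m%n<n; m%n%n≡m%n; m<n⇒m%n≡m; m≡m%n+[m/n]*n; [m+n]%n≡m%n; %-distribˡ-+)
  open import Data.Nat.Tactic.RingSolver using (solve-∀)
  open import Data.Vec.Base using (_∷_; here; there)
  open ≡ using (refl; sym; trans; cong; cong₂; subst; subst₂; module ≡-Reasoning)

  ∣⁅x⁆∪p∣ : ∀ {n} (x : Fin n) p → x ∉ˢ p → ∣ ⁅ x ⁆ ∪ p ∣ ≡ suc ∣ p ∣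
  ∣⁅x⁆∪p∣ zero    (inside  ∷ p) x∉p = ⊥-elim (x∉p here)
  ∣⁅x⁆∪p∣ zero    (outside ∷ p) x∉p = cong (suc ∘ ∣_∣) (∪-identityˡ p)
  ∣⁅x⁆∪p∣ (suc x) (inside  ∷ p) x∉p = cong suc (∣⁅x⁆∪p∣ x p (x∉p ∘ there))
  ∣⁅x⁆∪p∣ (suc x) (outside ∷ p) x∉p = ∣⁅x⁆∪p∣ x p (x∉p ∘ there)

  image : ∀ {m n} → (Fin m → Fin n) → Subset n
  image {zero}  f = ∅
  image {suc m} f = ⁅ f zero ⁆ ∪ image (f ∘ suc)

  ∈-image⁺ : ∀ {m n} (f : Fin m → Fin n) i → f i ∈ˢ image f
  ∈-image⁺ f zero    = x∈p∪q⁺ (inj₁ (x∈⁅x⁆ (f zero)))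
  ∈-image⁺ f (suc i) = x∈p∪q⁺ (inj₂ (∈-image⁺ (f ∘ suc) i))

  ∈-image⁻ : ∀ {m n} (f : Fin m → Fin n) {x} → x ∈ˢ image f → ∃ λ i → x ≡ f i
  ∈-image⁻ {zero}  f x∈ = ⊥-elim (∉⊥ x∈)
  ∈-image⁻ {suc m} f x∈ with x∈p∪q⁻ ⁅ f zero ⁆ (image (f ∘ suc)) x∈
  ... | inj₁ h = zero , x∈⁅y⁆⇒x≡y (f zero) h
  ... | inj₂ h = let i , eq = ∈-image⁻ (f ∘ suc) h in suc i , eq

  ∣image∣ : ∀ {m n} (f : Fin m → Fin n) → (∀ {i j} → f i ≡ f j → i ≡ j) → ∣ image f ∣ ≡ m
  ∣image∣ {zero}  {n} f inj = ∣⊥∣≡0 n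
  ∣image∣ {suc m}     f inj = trans (∣⁅x⁆∪p∣ (f zero) (image (f ∘ suc)) fresh) (cong suc (∣image∣ (f ∘ suc) (suc-injective ∘ inj)))
    where
    fresh : f zero ∉ˢ image (f ∘ suc)
    fresh h with ∈-image⁻ (f ∘ suc) h
    ... | i , eq with () ← inj eq

  module _ {n} (m : ℕ) (f : Fin (suc m) → Fin n) where

    private
      k = suc m
      U = cycVertex m f

    U-cong-% : ∀ x y → x % k ≡ y % k → U x ≡ U y
    U-cong-% x y eq = cong f (fromℕ<-cong (x % k) (y % k) eq (m%n<n x k) (m%n<n y k))

    %-+ : ∀ x t → (x % k + t) % k ≡ (x + t) % k
    %-+ x t = trans (%-distribˡ-+ (x % k) t k) (trans (cong (λ s → (s + t % k) % k) (m%n%n≡m%n x k)) (sym (%-distribˡ-+ x t k)))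

    U-periodic : ∀ x → U (x + k) ≡ U x
    U-periodic x = U-cong-% (x + k) x ([m+n]%n≡m%n x k)

    ∈-window⁺ : ∀ x {r} t → t < r → U (x + t) ∈ˢ window m f x r
    ∈-window⁺ x {suc r} t t<r with t ℕP.≟ r
    ... | yes refl = x∈p∪q⁺ (inj₁ (x∈⁅x⁆ _))
    ... | no  t≢r  = x∈p∪q⁺ (inj₂ (∈-window⁺ x t (ℕP.≤∧≢⇒< (ℕ.s≤s⁻¹ t<r) t≢r)))

    ∈-window⁻ : ∀ x {r y} → y ∈ˢ window m f x r → ∃ λ t → t < r × y ≡ U (x + t)
    ∈-window⁻ x {zero}  y∈ = ⊥-elim (∉⊥ y∈)
    ∈-window⁻ x {suc r} y∈ with x∈p∪q⁻ ⁅ U (x + r) ⁆ (window m f x r) y∈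
    ... | inj₁ h = r , ℕP.≤-refl , x∈⁅y⁆⇒x≡y _ h
    ... | inj₂ h = let t , t<r , eq = ∈-window⁻ x h in t , ℕP.m≤n⇒m≤1+n t<r , eq

    window-% : ∀ x r → window m f (x % k) r ≡ window m f x r
    window-% x zero    = refl
    window-% x (suc r) = cong₂ (λ v s → ⁅ v ⁆ ∪ s) (U-cong-% (x % k + r) (x + r) (%-+ x r)) (window-% x r)

    U-distinct : (∀ {i j} → f i ≡ f j → i ≡ j) → ∀ x d → d < k → U x ≡ U (x + d) → d ≡ 0
    U-distinct inj x d d<k eq = residues (m%n<n x k)
      (trans (fromℕ<-injective (x % k) ((x + d) % k) (m%n<n x k) (m%n<n (x + d) k) (inj eq)) (sym (%-+ x d)))
      where
      residues : ∀ {y} → y < k → y ≡ (y + d) % k → d ≡ 0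
      -- Without wrapping, y = y + d; with one wrap, y + k = y + d, which contradicts d < k.
      residues {y} y<k h with y + d ℕP.<? k
      ... | yes y+d<k = ℕP.+-cancelˡ-≡ y d 0 (trans (sym (trans h (m<n⇒m%n≡m y+d<k))) (sym (ℕP.+-identityʳ y)))
      ... | no  y+d≮k = ⊥-elim (ℕP.<⇒≢ d<k (ℕP.+-cancelˡ-≡ y d k (begin
        y + d           ≡⟨ ℕP.m∸n+n≡m k≤y+d ⟨
        z + k           ≡⟨ cong (_+ k) (m<n⇒m%n≡m z<k) ⟨
        z % k + k       ≡⟨ cong (_+ k) ([m+n]%n≡m%n z k) ⟨
        (z + k) % k + k ≡⟨ cong (λ s → s % k + k) (ℕP.m∸n+n≡m k≤y+d) ⟩
        (y + d) % k + k ≡⟨ cong (_+ k) h ⟨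
        y + k           ∎)))
        where
        open ≡-Reasoning
        k≤y+d = ℕP.≮⇒≥ y+d≮k
        z = y + d ∸ k
        z<k : z < k
        z<k = ℕP.+-cancelʳ-< k z k (subst (_< k + k) (sym (ℕP.m∸n+n≡m k≤y+d)) (ℕP.+-mono-< y<k d<k))

  -- Colours of the vertices u₀, u₁, … of a tight cycle of length k in an r-partite r-graph, and the closed
  -- walk formed by its vertices in the first two parts.
  module TightCycle
    {X V : Set} {r′ : ℕ}
    (vertex : Fin (2 + r′) → V → X) (vertex-injective : ∀ {c d v w} → vertex c v ≡ vertex d w → c ≡ d × v ≡ w)
    (k : ℕ) (r<k : 2 + r′ < k) (U : ℕ → X)
    (U-periodic : ∀ x → U (x + k) ≡ U x) (U-distinct : ∀ x d → d < k → U x ≡ U (x + d) → d ≡ 0)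
    (part : ℕ → Fin (2 + r′) → V)
    (cover : ∀ x c → ∃ λ t → t < 2 + r′ × U (x + t) ≡ vertex c (part x c))
    (within : ∀ x t → t < 2 + r′ → ∃ λ c → U (x + t) ≡ vertex c (part x c))
    (_∼_ : V → V → Set) (part-edge : ∀ x → part x zero ∼ part x (suc zero))
    where

    private
      r = 2 + r′

    Coloured : Fin r → ℕ → Set
    Coloured c x = ∃ λ v → U x ≡ vertex c v

    coloured-part : ∀ {c} x t → t < r → (h : Coloured c (x + t)) → proj₁ h ≡ part x c
    coloured-part {c} x t t<r (v , eq) with within x t t<r
    ... | d , eq′ with refl , h ← vertex-injective (trans (sym eq) eq′) = h

    -- The window at x is an edge with a single member in each part, so both positions carry that
    -- member.
    coloured-unique : ∀ {c} x d → d < r → Coloured c x → Coloured c (x + d) → d ≡ 0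
    coloured-unique {c} x d d<r (v , eq) h@(w , eq′) = U-distinct x d (ℕP.<-trans d<r r<k) (begin
      U x               ≡⟨ eq ⟩
      vertex c v        ≡⟨ cong (vertex c) (coloured-part x 0 (s≤s z≤n) (v , trans (cong U (ℕP.+-identityʳ x)) eq)) ⟩
      vertex c (part x c) ≡⟨ cong (vertex c) (coloured-part x d d<r h) ⟨
      vertex c w        ≡⟨ eq′ ⟨
      U (x + d)         ∎)
      where open ≡-Reasoning

    -- The window at x + 1 contains colour c. Its positions before x + r share a window with x and
    -- are excluded by `coloured-unique`.
    coloured-+r : ∀ {c} x → Coloured c x → Coloured c (x + r)
    coloured-+r {c} x h with cover (suc x) c
    ... | t , t<r , eq with suc t ℕP.≟ r
    ...   | yes refl = part (suc x) c , trans (cong U (ℕP.+-suc x t)) eq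
    ...   | no  st≢r with () ← coloured-unique x (suc t) (ℕP.≤∧≢⇒< t<r st≢r) h (part (suc x) c , trans (cong U (ℕP.+-suc x t)) eq)

    coloured-+*r : ∀ {c} x j → Coloured c x → Coloured c (x + j * r)
    coloured-+*r {c} x zero    h = subst (Coloured c) (sym (ℕP.+-identityʳ x)) h
    coloured-+*r {c} x (suc j) h = subst (Coloured c) (shuffle x j r) (coloured-+r (x + j * r) (coloured-+*r x j h))
      where
      shuffle : ∀ x j r → x + j * r + r ≡ x + suc j * r
      shuffle = solve-∀

    position₀ : ℕ
    position₀ = proj₁ (cover 0 zero)

    coloured₀ : Coloured zero position₀
    coloured₀ = part 0 zero , proj₂ (proj₂ (cover 0 zero))

    offset : ℕ
    offset = proj₁ (cover position₀ (suc zero))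

    offset<r : offset < r
    offset<r = proj₁ (proj₂ (cover position₀ (suc zero)))

    coloured₁ : Coloured (suc zero) (position₀ + offset)
    coloured₁ = part position₀ (suc zero) , proj₂ (proj₂ (cover position₀ (suc zero)))

    offset>0 : 0 < offset
    offset>0 = ℕP.n≢0⇒n>0 nonzero
      where
      nonzero : offset ≢ 0
      nonzero eq with () ← proj₁ (vertex-injective {zero} {suc zero} (trans (sym (proj₂ coloured₀))
        (trans (cong U (trans (sym (ℕP.+-identityʳ position₀)) (cong (position₀ +_) (sym eq)))) (proj₂ coloured₁))))

    q = k / r

    -- From `position₀`, colour zero recurs after q r steps and, by periodicity of U, after k steps.
    -- These positions differ by k mod r < r, hence not at all.
    k≡q*r : k ≡ q * r
    k≡q*r = trans (m≡m%n+[m/n]*n k r) (cong (_+ q * r) (coloured-unique (position₀ + q * r) (k % r) (m%n<n k r)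
        (coloured-+*r position₀ q coloured₀) (proj₁ coloured₀ , trans (cong U shuffle) (trans (U-periodic position₀) (proj₂ coloured₀)))))
      where
      shuffle : position₀ + q * r + k % r ≡ position₀ + k
      shuffle = trans (ℕP.+-assoc position₀ (q * r) (k % r)) (cong (position₀ +_) (trans (ℕP.+-comm (q * r) (k % r)) (sym (m≡m%n+[m/n]*n k r))))

    orbit : ∀ {c x} → Coloured c x → ℕ → V
    orbit {x = x} h j = proj₁ (coloured-+*r x j h)

    orbit-distinct : ∀ {c x} (h : Coloured c x) j → orbit h j ≢ orbit h (suc j)
    orbit-distinct {c} {x} h j eq = ℕP.1+n≢0 (U-distinct (x + j * r) r r<k
      (trans (proj₂ (coloured-+*r x j h)) (trans (cong (vertex c) eq) (trans (sym (proj₂ (coloured-+*r x (suc j) h))) (cong U (shuffle x j r))))))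
      where
      shuffle : ∀ x j r → x + suc j * r ≡ x + j * r + r
      shuffle = solve-∀

    orbit-periodic : ∀ {c x} (h : Coloured c x) j → orbit h (j + q) ≡ orbit h j
    orbit-periodic {c} {x} h j = proj₂ (vertex-injective {c} {c} (begin
      vertex c (orbit h (j + q)) ≡⟨ proj₂ (coloured-+*r x (j + q) h) ⟨
      U (x + (j + q) * r)        ≡⟨ cong U (shuffle x j q r) ⟩
      U (x + j * r + q * r)      ≡⟨ cong (λ s → U (x + j * r + s)) k≡q*r ⟨
      U (x + j * r + k)          ≡⟨ U-periodic (x + j * r) ⟩
      U (x + j * r)              ≡⟨ proj₂ (coloured-+*r x j h) ⟩
      vertex c (orbit h j)       ∎))
      where
      open ≡-Reasoning
      shuffle : ∀ x j q r → x + (j + q) * r ≡ x + j * r + q * r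
      shuffle = solve-∀

    -- Vertices of the first two parts in a common window belong to a common edge, which makes them
    -- adjacent in the graph.
    in-window : ∀ x y t {v w} → t < r → y ≡ x + t → U x ≡ vertex zero v → U y ≡ vertex (suc zero) w → v ∼ w
    in-window x y t t<r refl eq eq′ = subst₂ _∼_
      (sym (coloured-part x 0 (s≤s z≤n) (_ , trans (cong U (ℕP.+-identityʳ x)) eq)))
      (sym (coloured-part x t t<r (_ , eq′))) (part-edge x)

    in-window′ : ∀ x y t {v w} → t < r → y ≡ x + t → U x ≡ vertex (suc zero) w → U y ≡ vertex zero v → v ∼ w
    in-window′ x y t t<r refl eq eq′ = subst₂ _∼_
      (sym (coloured-part x t t<r (_ , eq′)))
      (sym (coloured-part x 0 (s≤s z≤n) (_ , trans (cong U (ℕP.+-identityʳ x)) eq))) (part-edge x)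

    q≥2 : 2 ≤ q
    q≥2 = ℕP.*-cancelʳ-< r 1 q (subst₂ _<_ (sym (ℕP.*-identityˡ r)) k≡q*r r<k)

    line-point : ∀ j → orbit coloured₀ j ∼ orbit coloured₁ j
    line-point j = in-window (position₀ + j * r) (position₀ + offset + j * r) offset offset<r (shuffle position₀ offset (j * r))
      (proj₂ (coloured-+*r position₀ j coloured₀)) (proj₂ (coloured-+*r (position₀ + offset) j coloured₁))
      where
      shuffle : ∀ x d y → x + d + y ≡ x + y + d
      shuffle = solve-∀

    point-line : ∀ j → orbit coloured₀ (suc j) ∼ orbit coloured₁ j
    -- The next vertex of part zero lies r - offset positions further, which is less than r because
    -- the offset is positive.
    point-line j = in-window′ (position₀ + offset + j * r) (position₀ + suc j * r) (r ∸ offset)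
      (ℕP.∸-monoʳ-< offset>0 (ℕP.<⇒≤ offset<r)) wrap
      (proj₂ (coloured-+*r (position₀ + offset) j coloured₁)) (proj₂ (coloured-+*r position₀ (suc j) coloured₀))
      where
      regroup : ∀ x d y e → x + d + y + e ≡ x + (e + d + y)
      regroup = solve-∀
      wrap : position₀ + suc j * r ≡ position₀ + offset + j * r + (r ∸ offset)
      wrap = sym (trans (regroup position₀ offset (j * r) (r ∸ offset)) (cong (λ s → position₀ + (s + j * r)) (ℕP.m∸n+n≡m (ℕP.<⇒≤ offset<r))))

    closedWalk : ClosedNonBacktrackingWalk _∼_ q
    closedWalk = record
      { v = orbit coloured₀
      ; w = orbit coloured₁
      ; v∼w = line-point
      ; sv∼w = point-line
      ; v-distinct = orbit-distinct coloured₀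
      ; w-distinct = orbit-distinct coloured₁
      ; v-periodic = orbit-periodic coloured₀
      ; w-periodic = orbit-periodic coloured₁
      }

  module Construction {p ℓ} (G : BipartiteGraph p ℓ) (r′ n : ℕ) (fits : (2 + r′) * p ^ ℓ ≤ n) where

    open BipartiteGraph G

    private
      r = 2 + r′
      M = p ^ ℓ

    vertex : Fin r → V → Fin n
    vertex c v = inject≤ (combine c v) fits

    vertex-injective : ∀ {c d v w} → vertex c v ≡ vertex d w → c ≡ d × v ≡ w
    vertex-injective {c} {d} {v} {w} eq = combine-injective c v d w (inject≤-injective fits fits _ _ eq)

    -- A vertex of the first part, one of its p neighbours and free vertices in the other r - 2
    -- parts.
    Index : Set
    Index = Fin (M * (p * M ^ r′))

    decode : Index → V × Fin p × Fin (M ^ r′)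
    decode i = let v , j = remQuot {M} (p * M ^ r′) i in v , remQuot {p} (M ^ r′) j

    decode-injective : ∀ {i j} → decode i ≡ decode j → i ≡ j
    decode-injective {i} {j} eq = begin
      i                                  ≡⟨ recover i ⟨
      encode (decode i)                  ≡⟨ cong encode eq ⟩
      encode (decode j)                  ≡⟨ recover j ⟩
      j                                  ∎
      where
      open ≡-Reasoning
      encode : V × Fin p × Fin (M ^ r′) → Index
      encode (v , a , g) = combine v (combine a g)
      recover : ∀ i → encode (decode i) ≡ i
      recover i = trans (cong (combine (proj₁ (remQuot {M} (p * M ^ r′) i))) (combine-remQuot {p} (M ^ r′) _)) (combine-remQuot {M} (p * M ^ r′) i)

    tuple : V × Fin p × Fin (M ^ r′) → Fin r → V
    tuple (v , a , g) zero          = v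
    tuple (v , a , g) (suc zero)    = neighbour v a
    tuple (v , a , g) (suc (suc c)) = finToFun g c

    tuple-injective : ∀ {x y} → (∀ c → tuple x c ≡ tuple y c) → x ≡ y
    tuple-injective {v , a , g} {w , b , h} eq with refl ← eq zero =
      cong₂ (λ a g → v , a , g) (neighbour-injective v (eq (suc zero))) (finToFun-injective {r′} {M} (λ c → eq (suc (suc c))))

    edge : Index → Subset n
    edge i = image (λ c → vertex c (tuple (decode i) c))

    -- A vertex determines its part, so the set determines the transversal tuple.
    edge-injective : ∀ {i j} → edge i ≡ edge j → i ≡ j
    edge-injective {i} {j} eq = decode-injective (tuple-injective agree)
      where
      agree : ∀ c → tuple (decode i) c ≡ tuple (decode j) c
      agree c with ∈-image⁻ (λ c → vertex c (tuple (decode j) c))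
                     (subst (vertex c (tuple (decode i) c) ∈ˢ_) eq (∈-image⁺ (λ c → vertex c (tuple (decode i) c)) c))
      ... | d , h with refl , k ← vertex-injective {c} {d} h = k

    hypergraph : RGraph r n
    hypergraph = record
      { edges = tabulate edge
      ; unique = Unique.tabulate⁺ edge-injective
      ; uniform = All.tabulate⁺ (λ i → ∣image∣ (λ c → vertex c (tuple (decode i) c)) (proj₁ ∘ vertex-injective)) }

    e-hypergraph : e hypergraph ≡ M * (p * M ^ r′)
    e-hypergraph = length-tabulate edge

    module _ (m : ℕ) (r<k : r < suc m) (f : Fin (suc m) → Fin n) (inj : ∀ {i j} → f i ≡ f j → i ≡ j)
             (windows : ∀ (i : Fin (suc m)) → window m f (toℕ i) r ∈ edges hypergraph) where

      private
        k = suc m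
        U = cycVertex m f

        windowEdge : ∀ x → ∃ λ i → window m f x r ≡ edge i
        windowEdge x = ∈-tabulate⁻ (subst (_∈ edges hypergraph)
          (trans (cong (λ s → window m f s r) (toℕ-fromℕ< (m%n<n x k))) (window-% m f x r)) (windows (fromℕ< (m%n<n x k))))

        selected : ℕ → V × Fin p × Fin (M ^ r′)
        selected x = decode (proj₁ (windowEdge x))

        cover : ∀ x c → ∃ λ t → t < r × U (x + t) ≡ vertex c (tuple (selected x) c)
        cover x c = let t , t<r , eq = ∈-window⁻ m f x (subst (vertex c (tuple (selected x) c) ∈ˢ_) (sym (proj₂ (windowEdge x)))
                                         (∈-image⁺ (λ c → vertex c (tuple (selected x) c)) c))
          in t , t<r , sym eq

        within : ∀ x t → t < r → ∃ λ c → U (x + t) ≡ vertex c (tuple (selected x) c)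
        within x t t<r = ∈-image⁻ (λ c → vertex c (tuple (selected x) c)) (subst (U (x + t) ∈ˢ_) (proj₂ (windowEdge x)) (∈-window⁺ m f x t t<r))

      no-tightCycle : k ≤ ℓ * r → ⊥
      no-tightCycle k≤ℓ*r = no-closed-walk q≥2 (ℕP.*-cancelʳ-≤ q ℓ r (subst (_≤ ℓ * r) k≡q*r k≤ℓ*r)) closedWalk
        where
        open TightCycle {r′ = r′} vertex (λ {c} {d} → vertex-injective {c} {d}) k r<k U (U-periodic m f) (U-distinct m f inj)
               (λ x → tuple (selected x)) cover within _∼_ (λ x → proj₁ (proj₂ (selected x)) , refl)

    hypergraph-TCFree : TCFree ℓ hypergraph
    hypergraph-TCFree zero    () k≤ _
    hypergraph-TCFree (suc m) r<k k≤ (f , inj , windows) = no-tightCycle m r<k f inj windows k≤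

-- Choice of the prime and the edge count

module Density where

  open import Data.Nat.Base
  open import Data.Nat.Properties
  open import Data.Nat.Tactic.RingSolver using (solve-∀)
  open ≡ using (refl; sym; trans; cong; module ≡-Reasoning)
  open Hypergraph

  ^-distribʳ-* : ∀ m n o → (m * n) ^ o ≡ m ^ o * n ^ o
  ^-distribʳ-* m n zero    = refl
  ^-distribʳ-* m n (suc o) = trans (cong (m * n *_) (^-distribʳ-* m n o)) (shuffle m n (m ^ o) (n ^ o))
    where
    shuffle : ∀ m n s t → m * n * (s * t) ≡ m * s * (n * t)
    shuffle = solve-∀

  n<2^n : ∀ n → n < 2 ^ n
  n<2^n zero    = s≤s z≤n
  n<2^n (suc n) = +-mono-≤ (m^n>0 2 n) (≤-trans (n<2^n n) (≤-reflexive (sym (+-identityʳ (2 ^ n)))))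

  m≤m^n : ∀ m n .{{_ : NonZero m}} → 0 < n → m ≤ m ^ n
  m≤m^n m n 0<n = ≤-trans (≤-reflexive (sym (*-identityʳ m))) (^-monoʳ-≤ m 0<n)

  -- Searches downwards from `m + t` for a crossing of the level n.
  bracket : ∀ (f : ℕ → ℕ) {n} t m → f t ≤ n → n < f (m + t) → ∃ λ s → t ≤ s × f s ≤ n × n < f (suc s)
  bracket f t zero    ft≤n n<ft = ⊥-elim (<⇒≱ n<ft ft≤n)
  bracket f {n} t (suc m) ft≤n n<f with n <? f (m + t)
  ... | yes n<f′ = bracket f t m ft≤n n<f′
  ... | no  n≮f′ = m + t , m≤n+m t m , ≮⇒≥ n≮f′ , n<f

  -- The gap exponent h stays a variable: Agda would unfold products with a literal such as 2 ^ 24 in unary.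
  module _ (r′ : ℕ) {ℓ} (ℓ∈ : ℓ ≡ 2 ⊎ ℓ ≡ 3 ⊎ ℓ ≡ 5)
    (h : ℕ) (prime-gap : ∀ t → ∃ λ p → Prime p × 2 ^ (t + t) < p × p ≤ 2 ^ (t + h + (t + h))) where

    private
      r = 2 + r′
      x = ℓ * suc r′ + 1
      scale : ℕ → ℕ
      -- The number of vertices sufficient for the largest p that `prime-gap t` may return. `K`
      -- below combines r with the ratio 4^(h + 1) between the next upper end and the current lower
      -- end.
      scale t = r * (2 ^ (t + h + (t + h))) ^ ℓ
      K = r * (2 ^ (2 + (h + h))) ^ ℓ

    scale-unbounded : ∀ n → n < scale (n + 1)
    scale-unbounded n = begin-strict
      n                            <⟨ n<2^n n ⟩
      2 ^ n                        ≤⟨ ^-monoʳ-≤ 2 (≤-trans (m≤m+n n 1) (≤-trans (m≤m+n (n + 1) h) (m≤m+n _ _))) ⟩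
      2 ^ (n + 1 + h + (n + 1 + h)) ≤⟨ m≤m^n _ ℓ {{m^n≢0 2 (n + 1 + h + (n + 1 + h))}} (ℓ>0 ℓ∈) ⟩
      (2 ^ (n + 1 + h + (n + 1 + h))) ^ ℓ ≤⟨ m≤m+n _ _ ⟩
      scale (n + 1)                ∎
      where open ≤-Reasoning

    scale-suc : ∀ {p} t → 2 ^ (t + t) ≤ p → scale (suc t) ≤ K * p ^ ℓ
    scale-suc {p} t le = begin
      r * (2 ^ (suc t + h + (suc t + h))) ^ ℓ ≡⟨ cong (λ s → r * (2 ^ s) ^ ℓ) (exponent t h) ⟩
      r * (2 ^ (2 + (h + h) + (t + t))) ^ ℓ     ≡⟨ cong (λ s → r * s ^ ℓ) (^-distribˡ-+-* 2 (2 + (h + h)) (t + t)) ⟩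
      r * (2 ^ (2 + (h + h)) * 2 ^ (t + t)) ^ ℓ   ≤⟨ *-monoʳ-≤ r (^-monoˡ-≤ ℓ (*-monoʳ-≤ (2 ^ (2 + (h + h))) le)) ⟩
      r * (2 ^ (2 + (h + h)) * p) ^ ℓ             ≡⟨ cong (r *_) (^-distribʳ-* (2 ^ (2 + (h + h))) p ℓ) ⟩
      r * ((2 ^ (2 + (h + h))) ^ ℓ * p ^ ℓ)       ≡⟨ *-assoc r ((2 ^ (2 + (h + h))) ^ ℓ) (p ^ ℓ) ⟨
      K * p ^ ℓ                        ∎
      where
      open ≤-Reasoning
      exponent : ∀ t h → suc t + h + (suc t + h) ≡ 2 + (h + h) + (t + t)
      exponent = solve-∀

    edge-count : ∀ p → p ^ ℓ * (p * (p ^ ℓ) ^ r′) ≡ p ^ x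
    edge-count p = begin
      p ^ ℓ * (p * (p ^ ℓ) ^ r′)       ≡⟨ cong (λ s → p ^ ℓ * (p * s)) (^-*-assoc p ℓ r′) ⟩
      p ^ ℓ * (p ^ (1 + ℓ * r′))       ≡⟨ ^-distribˡ-+-* p ℓ (1 + ℓ * r′) ⟨
      p ^ (ℓ + (1 + ℓ * r′))           ≡⟨ cong (p ^_) (exponent ℓ r′) ⟩
      p ^ x                            ∎
      where
      open ≡-Reasoning
      exponent : ∀ ℓ r → ℓ + (1 + ℓ * r) ≡ ℓ * suc r + 1
      exponent = solve-∀

    -- The bound is the ℓ-th power of the asymptotic one, which keeps exponents integral: (p^ℓ)^x =
    -- E^ℓ. The constant is a successor raised to ℓ to fit the final form.
    many-edges : ∀ {n p E} → n ≤ K * p ^ ℓ → E ≡ p ^ x → n ^ x ≤ suc (K ^ x) ^ ℓ * E ^ ℓ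
    many-edges {n} {p} n≤ refl = begin
      n ^ x                           ≤⟨ ^-monoˡ-≤ x n≤ ⟩
      (K * p ^ ℓ) ^ x                 ≡⟨ ^-distribʳ-* K (p ^ ℓ) x ⟩
      K ^ x * (p ^ ℓ) ^ x             ≤⟨ *-monoˡ-≤ ((p ^ ℓ) ^ x) (≤-trans (n≤1+n (K ^ x)) (m≤m^n (suc (K ^ x)) ℓ (ℓ>0 ℓ∈))) ⟩
      suc (K ^ x) ^ ℓ * (p ^ ℓ) ^ x   ≡⟨ cong (suc (K ^ x) ^ ℓ *_) (trans (^-*-assoc p ℓ x)
                                           (trans (cong (p ^_) (*-comm ℓ x)) (sym (^-*-assoc p x ℓ)))) ⟩
      suc (K ^ x) ^ ℓ * (p ^ x) ^ ℓ   ∎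
      where open ≤-Reasoning

    dense-TCFree : ∀ n → scale 1 ≤ n → Σ (RGraph r n) λ H → TCFree ℓ H × n ^ x ≤ suc (K ^ x) ^ ℓ * (e H) ^ ℓ
    dense-TCFree n N≤n with bracket scale 1 n N≤n (scale-unbounded n)
    ... | t , 1≤t , scale≤n , n<scale with prime-gap t
    ...   | p , pr , lower , upper = hypergraph , hypergraph-TCFree ,
        many-edges {n} {p} (≤-trans (<⇒≤ n<scale) (scale-suc t (<⇒≤ lower))) (trans e-hypergraph (edge-count p))
      where
      2<p : 2 < p
      -- The threshold `scale 1` guarantees t ≥ 1, which keeps p away from the excluded
      -- characteristic 2.
      2<p = ≤-<-trans (^-monoʳ-≤ 2 (≤-trans 1≤t (m≤m+n t t))) lower
      fits : r * p ^ ℓ ≤ n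
      fits = ≤-trans (*-monoʳ-≤ r (^-monoˡ-≤ ℓ upper)) scale≤n
      open Construction (Hexagon.bipartiteGraph pr 2<p ℓ∈) r′ n fits

open import Data.Nat using (_+_; _*_; _∸_; _^_; _≤_; z≤n; s≤s)

theorem1p7 : ∀ (r : ℕ) → 2 ≤ r → ∀ (ℓ : ℕ) → (ℓ ≡ 2 ⊎ ℓ ≡ 3 ⊎ ℓ ≡ 5) →
    Σ ℕ λ a → Σ ℕ λ N → ∀ (n : ℕ) → N ≤ n →
    Σ (RGraph r n) λ H → TCFree ℓ H ×
    (n ^ (ℓ * (r ∸ 1) + 1) ≤ (suc a) ^ ℓ * (e H) ^ ℓ)
theorem1p7 (suc (suc r′)) (s≤s (s≤s z≤n)) ℓ ℓ∈ =
  -- Unification supplies a = `K ^ x` and N = `scale 1`, both for the gap exponent 11.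
  _ , _ , Density.dense-TCFree r′ ℓ∈ 11 PrimeGap.prime-between
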